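{- Let $m,n\in\mathbb{N}$, $u\in S_{m+1}$ and $v\in S_{n+1}$. Then in $\mathbf{W}$, $$\nabla_{\mathrm{sh}}([u]\otimes[v])=\sum_{\pi\in\mathcal{S}(u,v)}[\pi].$$
   Context: Fix a field $\mathbb{k}$. A word is a finite sequence of positive integers; $\max(w)$ is its largest letter ($\max(\emptyset)=0$). $\mathbf{W}$ is the $\mathbb{k}$-vector space with basis symbols $[w,n]$ ($n\in\mathbb{N}$, $w$ a word with $\max(w)\le n$) and product $\nabla_{\mathrm{sh}}([v,m]\otimes[w,n])=\sum_{x}[x,m+n]$, the sum (with multiplicity) over all words $x$ obtained by shuffling $v$ with $w\uparrow m$ (i.e. over subsets $I$ of positions of size $\ell(v)$, $x$ having $v$ at positions $I$ and $w\uparrow m$ elsewhere), where $w\uparrow m$ adds $m$ to each letter. $S_n$ is the symmetric group, elements in one-line notation $\pi_1\cdots\pi_n$; $s_i=(i,i+1)$; $\mathcal{R}(\pi)$ is the set of reduced words (minimal-length words $i_1\cdots i_l$ with $\pi=s_{i_1}\cdots s_{i_l}$). For $\pi\in S_{n+1}$ put $[\pi]=\sum_{w\in\mathcal{R}(\pi)}[w,n]\in\mathbf{W}$. For a word $w$ with distinct letters, $\operatorname{fl}(w)$ replaces each letter by its rank among the letters of $w$. For words $a=a_1\cdots a_k$, $b=b_1\cdots b_l$ without repeated letters, with letter sets $A,B\subseteq\{1,\dots,k+l\}$, let $\phi:A\to\{1,\dots,k+l\}\setminus B$ and $\psi:B\to\{1,\dots,k+l\}\setminus A$ be the order-preserving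 bijections and set $a\mathbin{/\!\!/}b=a\,\psi(b)$ and $a\mathbin{\backslash\!\!\backslash}b=\phi(a)\,b$ (concatenations, letters mapped entrywise), elements of $S_{k+l}$. For $u\in S_{m+1}$, $v\in S_{n+1}$, the set $\mathcal{S}(u,v)\subseteq S_{m+n+1}$ is defined recursively (on $m+n$): let $w_i=v_i+m$ and let $j,k$ be the indices with $u_j=w_{k+1}=m+1$. (a) If $u_{m+1}=m+1$, $\mathcal{S}(u,v)=\{u_1\cdots u_m w_1\cdots w_{n+1}\}$. (b) If $w_1=m+1$, $\mathcal{S}(u,v)=\{u_1\cdots u_{m+1}w_2\cdots w_{n+1}\}$. (c) Otherwise, with $\tilde u=\operatorname{fl}(u_{j+1}\cdots u_{m+1})$ and $\tilde v=\operatorname{fl}(v_1\cdots v_k)$, $\mathcal{S}(u,v)=\{u_1\cdots u_j\mathbin{/\!\!/}\sigma:\sigma\in\mathcal{S}(\tilde u,v)\}\sqcup\{\sigma\mathbin{\backslash\!\!\backslash}w_{k+1}\cdots w_{n+1}:\sigma\in\mathcal{S}(u,\tilde v)\}$. -}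

module Defs where

open import Level using (Level; _⊔_) renaming (suc to lsuc)
open import Data.Nat using (ℕ; zero; suc; _≡ᵇ_; _<ᵇ_; pred)
import Data.Nat as ℕ
open import Data.Bool using (Bool; true; false; if_then_else_; _∧_; not)
open import Data.List using (List; []; _∷_; _++_; map; length; filterᵇ; concatMap; take; drop; upTo; foldl)
open import Data.Bool.ListAction using (any)
open import Data.Product using (Σ; _×_; _,_)
open import Relation.Nullary using (¬_)
open import Algebra.Bundles using (CommutativeRing)

record Field (c ℓ : Level) : Set (lsuc (c ⊔ ℓ)) where
  field
    commutativeRing : CommutativeRing c ℓ
  open CommutativeRing commutativeRing public
  field
    1≉0     : ¬ (1# ≈ 0#)
    inverse : ∀ x → ¬ (x ≈ 0#) → Σ Carrier (λ y → (x * y) ≈ 1#)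

Word : Set
Word = List ℕ

_==ᵂ_ : Word → Word → Bool
[] ==ᵂ [] = true
(x ∷ xs) ==ᵂ (y ∷ ys) = (x ≡ᵇ y) ∧ (xs ==ᵂ ys)
_ ==ᵂ _ = false

elemᵇ : ℕ → List ℕ → Bool
elemᵇ x = any (x ≡ᵇ_)

range1 : ℕ → List ℕ
range1 n = map suc (upTo n)

nth : List ℕ → ℕ → ℕ
nth [] _ = 0
nth (x ∷ xs) zero = x
nth (x ∷ xs) (suc i) = nth xs i

indexOf : ℕ → List ℕ → ℕ
indexOf x [] = 0
indexOf x (y ∷ ys) = if x ≡ᵇ y then 0 else suc (indexOf x ys)

headOr0 : List ℕ → ℕ
headOr0 [] = 0
headOr0 (x ∷ _) = x

lastOr0 : List ℕ → ℕ
lastOr0 [] = 0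
lastOr0 (x ∷ []) = x
lastOr0 (_ ∷ y ∷ ys) = lastOr0 (y ∷ ys)

-- Symmetric group, one-line notation: π ∈ S_{n+1} is a list π₁⋯π_{n+1}.

-- σ ↦ σ ∘ s_i in one-line notation: swap the entries at positions i, i+1 (1-based)
swapAt : ℕ → List ℕ → List ℕ
swapAt (suc zero) (a ∷ b ∷ xs) = b ∷ a ∷ xs
swapAt (suc (suc i)) (a ∷ xs) = a ∷ swapAt (suc i) xs
swapAt _ xs = xs

-- one-line notation of s_{i₁} ∘ s_{i₂} ∘ ⋯ ∘ s_{i_l} ∈ S_{n+1}
evalWord : ℕ → Word → List ℕ
evalWord n w = foldl (λ σ i → swapAt i σ) (range1 (suc n)) w

wordsOfLength : ℕ → ℕ → List Word
wordsOfLength n zero = [] ∷ []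
wordsOfLength n (suc L) = concatMap (λ i → map (i ∷_) (wordsOfLength n L)) (range1 n)

wordsWithProduct : ℕ → List ℕ → ℕ → List Word
wordsWithProduct n π L = filterᵇ (λ w → evalWord n w ==ᵂ π) (wordsOfLength n L)

firstNonEmpty : List (List Word) → List Word
firstNonEmpty [] = []
firstNonEmpty ([] ∷ rest) = firstNonEmpty rest
firstNonEmpty ((x ∷ xs) ∷ rest) = x ∷ xs

-- 𝓡(π) for π ∈ S_{n+1}: the words of minimal length among all words with
-- product π (lengths are searched from 0 upwards; n * n bounds the length
-- n(n+1)/2 of the longest element of S_{n+1}).
reducedWords : ℕ → List ℕ → List Word
reducedWords n π = firstNonEmpty (map (wordsWithProduct n π) (upTo (suc (n ℕ.* n))))

-- The space 𝐖.  An element is represented as a formal sum (list, with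
-- multiplicity) of basis symbols [w , n]; two formal sums are equal in 𝐖
-- over the field K iff every basis symbol has the same coefficient in K.

Basis : Set
Basis = Word × ℕ

FormalSum : Set
FormalSum = List Basis

eqBasis : Basis → Basis → Bool
eqBasis (w , n) (w′ , n′) = (w ==ᵂ w′) ∧ (n ≡ᵇ n′)

count : Basis → FormalSum → ℕ
count b L = length (filterᵇ (eqBasis b) L)

module _ {c ℓ} (K : Field c ℓ) where
  open Field K

  ιℕ : ℕ → Carrier
  ιℕ zero = 0#
  ιℕ (suc k) = 1# + ιℕ k

  _≈W_ : FormalSum → FormalSum → Set ℓ
  L ≈W R = ∀ (b : Basis) → ιℕ (count b L) ≈ ιℕ (count b R)

bracket : ℕ → List ℕ → FormalSum
bracket n π = map (λ w → (w , n)) (reducedWords n π)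

shift : ℕ → Word → Word
shift m w = map (ℕ._+ m) w

-- all shuffles, with multiplicity (one per choice of position set I)
shuffles : Word → Word → List Word
shuffles [] ys = ys ∷ []
shuffles (x ∷ xs) [] = (x ∷ xs) ∷ []
shuffles (x ∷ xs) (y ∷ ys) =
  map (x ∷_) (shuffles xs (y ∷ ys)) ++ map (y ∷_) (shuffles (x ∷ xs) ys)

∇shBasis : Basis → Basis → FormalSum
∇shBasis (v , m) (w , n) = map (λ x → (x , m ℕ.+ n)) (shuffles v (shift m w))

∇sh : FormalSum → FormalSum → FormalSum
∇sh L R = concatMap (λ a → concatMap (∇shBasis a) R) L

fl : Word → Word
fl w = map (λ x → suc (length (filterᵇ (_<ᵇ x) w))) w

compl : List ℕ → ℕ → List ℕ
compl A N = filterᵇ (λ y → not (elemᵇ y A)) (range1 N)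

-- order-preserving bijection B → {1..N} ∖ A, applied to x ∈ B
orderMap : List ℕ → List ℕ → ℕ → ℕ → ℕ
orderMap A B N x = nth (compl A N) (length (filterᵇ (_<ᵇ x) B))

_//_ : Word → Word → Word
a // b = a ++ map (orderMap a b (length a ℕ.+ length b)) b

_\\_ : Word → Word → Word
a \\ b = map (orderMap b a (length a ℕ.+ length b)) a ++ b

-- 𝓢(u,v) with a fuel argument (the recursion is on m+n; fuel
-- length u + length v is always sufficient, see 𝓢 below)
𝓢′ : ℕ → Word → Word → List Word
𝓢′ zero u v = []
𝓢′ (suc f) u v =
  if lastOr0 u ≡ᵇ suc m then (take m u ++ w) ∷ []
  else if headOr0 w ≡ᵇ suc m then (u ++ drop 1 w) ∷ []
  else (map (take j u //_) (𝓢′ f ũ v) ++ map (_\\ drop k w) (𝓢′ f u ṽ))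
  where
    m : ℕ
    m = pred (length u)
    w : Word
    w = map (ℕ._+ m) v
    j : ℕ            -- 1-based index with u_j = m+1
    j = suc (indexOf (suc m) u)
    k : ℕ            -- w_{k+1} = m+1
    k = indexOf (suc m) w
    ũ : Word
    ũ = fl (drop j u)
    ṽ : Word
    ṽ = fl (take k v)

𝓢 : Word → Word → List Word
𝓢 u v = 𝓢′ (length u ℕ.+ length v) u v

{-# OPTIONS --safe #-}

-- The largest letter of u and the smallest letter of the shifted word w = v ↑ m are
-- the same number m + 1.  Cutting u at its right-to-left maxima and w at its
-- left-to-right minima turns the recursion for 𝓢(u,v) into a recursion over two lists
-- of blocks that never relabels a letter (mix), up to order-preserving renaming.
-- On that form one sees: if u has a descent at a position i ≤ m, then undoing the
-- descent at i is a bijection from the members of 𝓢(u,v) with a descent at i onto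
-- 𝓢(u sᵢ,v); if u has no descent at i, no member has one.  The mirror image of this
-- (reverse the words and the order of the letters) treats the positions belonging to v.
-- Since a word is reduced for π iff reading it backwards undoes a descent of π at each
-- step and ends at the identity, induction on the length of x shows that x is reduced
-- for exactly one member of 𝓢(u,v) (with multiplicity one) if its letters ≤ m form a
-- reduced word of u and its other letters one of v, and for none otherwise.  That is the
-- coefficient of x in the shuffle product.

module Submission where

open import Defs
open import Data.Nat using (ℕ; zero; suc; pred; _+_; _*_; _∸_; _≤_; _<_; z≤n; s≤s; _<ᵇ_; _≡ᵇ_; >-nonZero)
import Data.Nat.Properties as ℕₚ
open import Data.Nat.ListAction using (sum)
open import Data.Nat.ListAction.Properties using (sum-++; sum-↭)
open import Data.Bool using (Bool; true; false; if_then_else_; not; _∧_; T?)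
open import Data.Bool.Properties using (T-≡; ¬-not)
open import Data.Empty using (⊥)
open import Data.List using (List; []; _∷_; _++_; map; length; reverse; mapMaybe; take; drop; filterᵇ; foldr; upTo; applyUpTo)
open import Data.List using (concatMap)
open import Data.List.Properties hiding (sum-++)
open import Data.List.Membership.Propositional using (_∈_; _∉_)
open import Data.List.Membership.Propositional.Properties using (∈-++⁺ʳ; ∈-++⁺ˡ; ∈-∃++; ∈-map⁺; ∈-insert)
open import Data.List.Relation.Binary.Permutation.Propositional using (_↭_)
open import Data.List.Relation.Binary.Permutation.Propositional
  using (prep; swap; ↭-refl; ↭-sym; ↭-trans; ↭-reflexive; ↭⇒↭ₛ; module PermutationReasoning)
open import Data.List.Relation.Binary.Permutation.Propositional.Properties
  using (All-resp-↭; ∈-resp-↭; ↭-length; ↭-reverse; ++⁺ˡ; ++⁺ʳ; ++⁺; ++-comm; filter-↭; drop-mid)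
  renaming (shift to ↭-shift; map⁺ to ↭-map⁺)
import Data.List.Relation.Binary.Permutation.Setoid.Properties as ↭ₛ
open import Data.List.Relation.Binary.Pointwise using (Pointwise-≡⇒≡)
open import Data.List.Relation.Unary.All as All using (All; []; _∷_)
import Data.List.Relation.Unary.All.Properties as Allₚ
open import Data.List.Relation.Unary.AllPairs as AllPairs using (AllPairs; []; _∷_)
import Data.List.Relation.Unary.AllPairs.Properties as AllPairsₚ
open import Data.List.Relation.Unary.Any using (here; there)
open import Data.List.Relation.Unary.Linked using (Linked; []; [-]; _∷_)
import Data.List.Relation.Unary.Sorted.TotalOrder.Properties as Sortedₚ
open import Data.List.Relation.Unary.Unique.Propositional using (Unique)
import Data.List.Relation.Unary.Unique.Propositional.Properties as Uniqueₚ
open import Data.Maybe as Maybe using (Maybe; just; nothing; maybe′)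
open import Data.Product using (∃; ∃₂; _×_; _,_; proj₁; proj₂)
open import Data.Sum using (_⊎_; inj₁; inj₂)
open import Function using (_∘_; flip; case_of_; id; Equivalence)
open import Relation.Binary.Definitions using (tri<; tri≈; tri>)
open import Relation.Binary.PropositionalEquality
open import Relation.Nullary using (contradiction)

-- The two words share the letter `c`: the other letters of the first lie below it, those of the
-- second above it. When a branch uses up `c`, the next maximum `M` of the first word (or the next
-- minimum of the second) takes the vacant place in the other word, and it bounds that word as `c`
-- did because `M < c`. So every letter can carry its final value from the start. A member has m + n
-- + 1 letters because one letter is shared. Its m + n adjacent pairs are matched by position with
-- the m pairs of `u` and the n pairs of `v`, so every letter of a reduced word acts on exactly one
-- of the two words. The second word is stored reversed. Mirroring then just exchanges the arguments
-- of `mix`, and the claim about descents is proved once, for an abstract order that is later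
-- instantiated with `<` and its opposite. Bijections appear as equalities of sums: multiplicities
-- are natural numbers, obtained by adding 0/1 indicators over lists, and equal counts have equal
-- images in the field.

Unique-resp-↭ : ∀ {xs ys : Word} → xs ↭ ys → Unique xs → Unique ys
Unique-resp-↭ p = ↭ₛ.Unique-resp-↭ (setoid ℕ) (↭⇒↭ₛ p)

drop-length : ∀ (p s : Word) → drop (length p) (p ++ s) ≡ s
drop-length [] s = refl
drop-length (x ∷ p) s = drop-length p s

-- Blocks and the recursion without relabelling

-- u = p ++ c ∷ flat U, where c and the first components of U are the right-to-left maxima
-- of u; mirrored, the second word is w = reverse (r ++ c ∷ flat V), where c and the first
-- components of V are its left-to-right minima.
Blocks : Set
Blocks = List (ℕ × Word)

flat : Blocks → Word
flat [] = []
flat ((M , p) ∷ U) = p ++ M ∷ flat U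

-- The clauses are the cases (a), (b), (c) of the recursion for `𝓢`. In (c) the first argument of
-- each recursive call is the letter that takes over the role of `c` in both words.
mix : ℕ → Word → Blocks → Word → Blocks → List Word
mix c p [] r V = (p ++ reverse (r ++ c ∷ flat V)) ∷ []
mix c p U@(_ ∷ _) r [] = ((p ++ c ∷ flat U) ++ reverse r) ∷ []
mix c p ((M , p′) ∷ U) r ((m , r′) ∷ V) =
  map ((p ++ c ∷ []) ++_) (mix M p′ U r ((m , r′) ∷ V)) ++
  map (_++ reverse (r ++ c ∷ [])) (mix m p ((M , p′) ∷ U) r′ V)

map-++-assoc : ∀ (x y : Word) L → map ((x ++ y) ++_) L ≡ map (x ++_) (map (y ++_) L)
map-++-assoc x y L = trans (map-cong (++-assoc x y) L) (map-∘ L)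

++-map-comm : ∀ (x y : Word) L → map (_++ y) (map (x ++_) L) ≡ map (x ++_) (map (_++ y) L)
++-map-comm x y L = trans (sym (map-∘ L)) (trans (map-cong (λ z → ++-assoc x z y) L) (map-∘ L))

mix-prefix : ∀ c q p U r V → mix c (q ++ p) U r V ≡ map (q ++_) (mix c p U r V)
mix-prefix c q p [] r V = cong (_∷ []) (++-assoc q p _)
mix-prefix c q p U@(_ ∷ _) r [] = cong (_∷ []) (trans (cong (_++ reverse r) (++-assoc q p _)) (++-assoc q _ _))
mix-prefix c q p ((M , p′) ∷ U) r V@((m , r′) ∷ V′) = begin
  map (((q ++ p) ++ c ∷ []) ++_) A ++ map (_++ s) (mix m (q ++ p) ((M , p′) ∷ U) r′ V′)
    ≡⟨ cong₂ _++_ (trans (cong (λ z → map (z ++_) A) (++-assoc q p _)) (map-++-assoc q _ A))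
                  (trans (cong (map (_++ s)) (mix-prefix m q p ((M , p′) ∷ U) r′ V′)) (++-map-comm q s B)) ⟩
  map (q ++_) (map ((p ++ c ∷ []) ++_) A) ++ map (q ++_) (map (_++ s) B)
    ≡⟨ map-++ (q ++_) (map ((p ++ c ∷ []) ++_) A) (map (_++ s) B) ⟨
  map (q ++_) (map ((p ++ c ∷ []) ++_) A ++ map (_++ s) B) ∎
  where
  open ≡-Reasoning
  A = mix M p′ U r V
  B = mix m p ((M , p′) ∷ U) r′ V′
  s = reverse (r ++ c ∷ [])

-- When the second word starts with `c`, cases (a) and (b) glue at the same letter and agree, so the
-- result is uniform in `U`.
mix-[] : ∀ c p U r → mix c p U r [] ≡ (p ++ c ∷ flat U ++ reverse r) ∷ []
mix-[] c p [] r = cong (λ z → (p ++ z) ∷ []) (reverse-++ r (c ∷ []))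
mix-[] c p (u ∷ U) r = cong (_∷ []) (++-assoc p (c ∷ flat (u ∷ U)) (reverse r))

mix-[][] : ∀ c p U → mix c p U [] [] ≡ (p ++ c ∷ flat U) ∷ []
mix-[][] c p U = trans (mix-[] c p U []) (cong (λ z → (p ++ c ∷ z) ∷ []) (++-identityʳ (flat U)))

mirror-++ : ∀ (p L : Word) → reverse (p ++ reverse L) ≡ L ++ reverse p
mirror-++ p L = trans (reverse-++ p (reverse L)) (cong (_++ reverse p) (reverse-involutive L))

-- Reversing a member exchanges the two words and hence the two branches. These come out in the
-- opposite order, so the lists agree only up to permutation.
mix-mirror : ∀ c p U r V → map reverse (mix c p U r V) ↭ mix c r V p U
mix-mirror c p [] r [] = ↭-reflexive (cong (_∷ []) (trans (mirror-++ p (r ++ c ∷ []))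
   (trans (++-assoc r (c ∷ []) _) (cong (r ++_) (sym (reverse-++ p (c ∷ [])))))))
mix-mirror c p [] r (v ∷ V) = ↭-reflexive (cong (_∷ []) (mirror-++ p _))
mix-mirror c p (u ∷ U) r [] = ↭-reflexive (cong (_∷ []) (trans (reverse-++ (p ++ c ∷ flat (u ∷ U)) (reverse r)) (cong (_++ reverse (p ++ c ∷ flat (u ∷ U))) (reverse-involutive r))))
mix-mirror c p U@((M , p′) ∷ U′) r V@((m , r′) ∷ V′) = begin
  map reverse (map ((p ++ c ∷ []) ++_) A ++ map (_++ reverse (r ++ c ∷ [])) B)
    ≡⟨ map-++ reverse (map ((p ++ c ∷ []) ++_) A) _ ⟩
  map reverse (map ((p ++ c ∷ []) ++_) A) ++ map reverse (map (_++ reverse (r ++ c ∷ [])) B)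
    ≡⟨ cong₂ _++_ (rev-map (λ x → reverse-++ (p ++ c ∷ []) x) A)
         (rev-map (λ x → trans (reverse-++ x _) (cong (_++ reverse x) (reverse-involutive (r ++ c ∷ [])))) B) ⟩
  map (_++ reverse (p ++ c ∷ [])) (map reverse A) ++ map ((r ++ c ∷ []) ++_) (map reverse B)
    ↭⟨ ++⁺ (↭-map⁺ _ (mix-mirror M p′ U′ r V)) (↭-map⁺ _ (mix-mirror m p U r′ V′)) ⟩
  map (_++ reverse (p ++ c ∷ [])) (mix M r V p′ U′) ++ map ((r ++ c ∷ []) ++_) (mix m r′ V′ p U)
    ↭⟨ ++-comm (map (_++ reverse (p ++ c ∷ [])) (mix M r V p′ U′)) _ ⟩
  map ((r ++ c ∷ []) ++_) (mix m r′ V′ p U) ++ map (_++ reverse (p ++ c ∷ [])) (mix M r V p′ U′) ∎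
  where
  open PermutationReasoning
  A = mix M p′ U′ r V
  B = mix m p U r′ V′
  rev-map : ∀ {f g : Word → Word} → (∀ x → reverse (f x) ≡ g (reverse x)) → ∀ L → map reverse (map f L) ≡ map g (map reverse L)
  rev-map eq L = trans (sym (map-∘ L)) (trans (map-cong eq L) (map-∘ L))

mix-↭ : ∀ c p U r V → All (_↭ (p ++ flat U) ++ c ∷ (r ++ flat V)) (mix c p U r V)
mix-↭ c p [] r V = ↭-trans (++⁺ˡ p (↭-trans (↭-reverse _) (↭-shift c r (flat V)))) (↭-reflexive (cong (_++ c ∷ r ++ flat V) (sym (++-identityʳ p)))) ∷ []
mix-↭ c p U@(_ ∷ _) r [] = (begin
  (p ++ c ∷ flat U) ++ reverse r ↭⟨ ++⁺ (↭-shift c p (flat U)) (↭-reverse r) ⟩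
  c ∷ (p ++ flat U) ++ r ↭⟨ ↭-shift c (p ++ flat U) r ⟨
  (p ++ flat U) ++ c ∷ r ≡⟨ cong (λ z → (p ++ flat U) ++ c ∷ z) (++-identityʳ r) ⟨
  (p ++ flat U) ++ c ∷ (r ++ []) ∎) ∷ []
  where open PermutationReasoning
mix-↭ c p U@((M , p′) ∷ U′) r V@((m , r′) ∷ V′) =
  Allₚ.++⁺ (Allₚ.map⁺ (All.map left (mix-↭ M p′ U′ r V))) (Allₚ.map⁺ (All.map right (mix-↭ m p U r′ V′)))
  where
  open PermutationReasoning
  X = r ++ flat V
  left : ∀ {x} → x ↭ (p′ ++ flat U′) ++ M ∷ X → (p ++ c ∷ []) ++ x ↭ (p ++ flat U) ++ c ∷ X
  left {x} q = begin
    (p ++ c ∷ []) ++ x ↭⟨ ++⁺ˡ (p ++ c ∷ []) q ⟩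
    (p ++ c ∷ []) ++ (p′ ++ flat U′) ++ M ∷ X ≡⟨ ++-assoc p (c ∷ []) _ ⟩
    p ++ c ∷ ((p′ ++ flat U′) ++ M ∷ X) ↭⟨ ++⁺ˡ p (prep c (↭-shift M (p′ ++ flat U′) X)) ⟩
    p ++ c ∷ (M ∷ p′ ++ flat U′) ++ X ↭⟨ ++⁺ˡ p (prep c (++⁺ʳ X (↭-shift M p′ (flat U′)))) ⟨
    p ++ c ∷ flat U ++ X ↭⟨ ++⁺ˡ p (↭-shift c (flat U) X) ⟨
    p ++ flat U ++ c ∷ X ≡⟨ ++-assoc p (flat U) _ ⟨
    (p ++ flat U) ++ c ∷ X ∎
  right : ∀ {x} → x ↭ (p ++ flat U) ++ m ∷ (r′ ++ flat V′) → x ++ reverse (r ++ c ∷ []) ↭ (p ++ flat U) ++ c ∷ X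
  right {x} q = begin
    x ++ reverse (r ++ c ∷ []) ↭⟨ ++⁺ q (↭-trans (↭-reverse (r ++ c ∷ [])) (++-comm r (c ∷ []))) ⟩
    ((p ++ flat U) ++ m ∷ (r′ ++ flat V′)) ++ c ∷ r ≡⟨ ++-assoc (p ++ flat U) _ _ ⟩
    (p ++ flat U) ++ (m ∷ (r′ ++ flat V′)) ++ c ∷ r ↭⟨ ++⁺ˡ (p ++ flat U) (↭-shift c (m ∷ (r′ ++ flat V′)) r) ⟩
    (p ++ flat U) ++ c ∷ (m ∷ (r′ ++ flat V′)) ++ r ↭⟨ ++⁺ˡ (p ++ flat U) (prep c (++⁺ʳ r (↭-shift m r′ (flat V′)))) ⟨
    (p ++ flat U) ++ c ∷ flat V ++ r ↭⟨ ++⁺ˡ (p ++ flat U) (prep c (++-comm (flat V) r)) ⟩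
    (p ++ flat U) ++ c ∷ X ∎

-- The certificate that `c` and the first components are successive extrema: each lies below the one
-- before it and bounds its own segment.
data Below (R : ℕ → ℕ → Set) : ℕ → Blocks → Set where
  [] : ∀ {c} → Below R c []
  cons : ∀ {c M p U} → R M c → All (λ x → R x M) p → Below R M U → Below R c ((M , p) ∷ U)

module _ {R : ℕ → ℕ → Set} (R-trans : ∀ {a b c} → R a b → R b c → R a c) where

  Below-flat : ∀ {c U} → Below R c U → All (λ x → R x c) (flat U)
  Below-flat [] = []
  Below-flat (cons M<c p<M b) =
    Allₚ.++⁺ (All.map (λ x → R-trans x M<c) p<M) (M<c ∷ All.map (λ x → R-trans x M<c) (Below-flat b))

  Below-weaken : ∀ {c d U} → Below R c U → R c d → Below R d U
  Below-weaken [] _ = []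
  Below-weaken (cons M<c q b) c<d = cons (R-trans M<c c<d) q b

-- Undoing a descent in the members of a mix

module Order (lt : ℕ → ℕ → Bool)
  (lt-asym : ∀ {a b} → lt a b ≡ true → lt b a ≡ false)
  (lt-trans : ∀ {a b c} → lt a b ≡ true → lt b c ≡ true → lt a c ≡ true) where

  _≺_ : ℕ → ℕ → Set
  a ≺ b = lt a b ≡ true

  -- Positions count from 0. The value `nothing` stands both for an ascent and for a position
  -- outside the word.
  step : ℕ → Word → Maybe Word
  step zero (a ∷ b ∷ xs) = if lt b a then just (b ∷ a ∷ xs) else nothing
  step (suc i) (a ∷ xs) = Maybe.map (a ∷_) (step i xs)
  step _ _ = nothing

  -- The blocks of the word obtained from p ++ c ∷ flat U by undoing the descent at i.  There
  -- is no descent into the maximum c; swapping c with the letter after it either moves that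
  -- letter into p or merges two blocks.
  low : ℕ → Word → Blocks → Maybe (Word × Blocks)
  low zero [] ((M , []) ∷ U) = just (M ∷ [] , U)
  low zero [] ((M , a ∷ p) ∷ U) = just (a ∷ [] , (M , p) ∷ U)
  low (suc i) [] ((M , p) ∷ U) = Maybe.map (λ (p′ , U′) → [] , (M , p′) ∷ U′) (low i p U)
  low zero (a ∷ b ∷ p) U = if lt b a then just (b ∷ a ∷ p , U) else nothing
  low (suc i) (a ∷ p) U = Maybe.map (λ (p′ , U′) → a ∷ p′ , U′) (low i p U)
  low _ _ _ = nothing

  low-valid : ∀ {c} i p U {p′ U′} → All (_≺ c) p → Below _≺_ c U → low i p U ≡ just (p′ , U′) →
    All (_≺ c) p′ × Below _≺_ c U′
  -- `M` moves in front of `c` and stops being a right-to-left maximum; the later blocks lie below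
  -- `M`, hence below `c`.
  low-valid zero [] ((M , []) ∷ U) a (cons M≺c _ b) refl = (M≺c ∷ []) , Below-weaken lt-trans b M≺c
  low-valid zero [] ((M , x ∷ p) ∷ U) a (cons M≺c (q ∷ qs) b) refl = (lt-trans q M≺c ∷ []) , cons M≺c qs b
  low-valid (suc i) [] ((M , p) ∷ U) a (cons M≺c q b) eq with low i p U in e
  low-valid (suc i) [] ((M , p) ∷ U) a (cons M≺c q b) refl | just _ with low-valid i p U q b e
  ... | q′ , b′ = [] , cons M≺c q′ b′
  low-valid zero (x ∷ y ∷ p) U (px ∷ py ∷ a) b eq with lt y x
  low-valid zero (x ∷ y ∷ p) U (px ∷ py ∷ a) b refl | true = (py ∷ px ∷ a) , b
  low-valid (suc i) (x ∷ p) U (px ∷ a) b eq with low i p U in e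
  low-valid (suc i) (x ∷ p) U (px ∷ a) b refl | just _ with low-valid i p U a b e
  ... | q′ , b′ = (px ∷ q′) , b′

  mixs : ℕ → Maybe (Word × Blocks) → Word → Blocks → List Word
  mixs c nothing r V = []
  mixs c (just (p , U)) r V = mix c p U r V

  StartsAbove : ℕ → Word → Set
  StartsAbove a [] = ⊥
  StartsAbove a (h ∷ _) = a ≺ h

  StartsAbove-++ : ∀ {a x y} → StartsAbove a x → StartsAbove a (x ++ y)
  StartsAbove-++ {x = _ ∷ _} s = s

  StartsAbove-reverse : ∀ {a} r c F → All (a ≺_) (c ∷ F) → StartsAbove a (reverse (r ++ c ∷ F))
  StartsAbove-reverse r c F al rewrite reverse-++ r (c ∷ F) with reverse (c ∷ F) in e | All-resp-↭ (↭-sym (↭-reverse (c ∷ F))) al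
  ... | [] | _ = contradiction (trans (sym (length-reverse (c ∷ F))) (cong length e)) λ ()
  ... | _ ∷ _ | h ∷ _ = h

  -- Each member has the shared letter in addition, so a pair at a position below
  -- `length (p ++ flat U)` lies entirely inside it, whatever suffix is attached afterwards.
  mix-nonempty : ∀ c p U r V → All (λ x → length (p ++ flat U) < length x) (mix c p U r V)
  mix-nonempty c p U r V = All.map f (mix-↭ c p U r V)
    where
    f : ∀ {x} → x ↭ (p ++ flat U) ++ c ∷ (r ++ flat V) → length (p ++ flat U) < length x
    f q rewrite ↭-length q | length-++ (p ++ flat U) {c ∷ (r ++ flat V)} =
      ℕₚ.m<m+n _ (s≤s z≤n)

  -- With nothing in front of `c`, a member starts with `c`, with a later minimum that took its
  -- place, or with a letter of `flat V`. A letter `a` put before it therefore begins an ascent.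
  mix-startsAbove : ∀ {a} c U r V → a ≺ c → All (a ≺_) (flat V) → All (StartsAbove a) (mix c [] U r V)
  mix-startsAbove c [] r V a≺c a≺V = StartsAbove-reverse r c (flat V) (a≺c ∷ a≺V) ∷ []
  mix-startsAbove c (_ ∷ _) r [] a≺c a≺V = a≺c ∷ []
  mix-startsAbove c U@((M , p′) ∷ U′) r V@((m , r′) ∷ V′) a≺c a≺V =
    Allₚ.++⁺ (Allₚ.map⁺ (All.universal (λ _ → a≺c) _))
      (Allₚ.map⁺ (All.map (λ {x} → StartsAbove-++ {x = x})
        (mix-startsAbove m U r′ V′ (All.head (Allₚ.++⁻ʳ r′ a≺V)) (All.tail (Allₚ.++⁻ʳ r′ a≺V)))))

  undo : ℕ → List Word → List Word
  undo i = mapMaybe (step i)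

  undo-suc : ∀ i a L → undo (suc i) (map (a ∷_) L) ≡ map (a ∷_) (undo i L)
  undo-suc i a L = trans (mapMaybe-map (step (suc i)) (a ∷_) L) (sym (map-mapMaybe (a ∷_) (step i) L))

  mapMaybe-none : ∀ {f : Word → Maybe Word} {L} → All (λ x → f x ≡ nothing) L → mapMaybe f L ≡ []
  mapMaybe-none [] = refl
  mapMaybe-none (eq ∷ al) rewrite eq = mapMaybe-none al

  undo-ascent : ∀ a {L} → All (StartsAbove a) L → undo 0 (map (a ∷_) L) ≡ []
  undo-ascent a {L} al = mapMaybe-none (Allₚ.map⁺ (All.map (λ {x} → f x) al))
    where
    f : ∀ x → StartsAbove a x → step 0 (a ∷ x) ≡ nothing
    f (b ∷ x) s rewrite lt-asym s = refl

  undo-swap : ∀ {a b} L → b ≺ a → undo 0 (map (a ∷_) (map (b ∷_) L)) ≡ map (b ∷_) (map (a ∷_) L)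
  undo-swap [] _ = refl
  undo-swap (x ∷ L) b≺a rewrite b≺a = cong (_ ∷_) (undo-swap L b≺a)

  undo-no-swap : ∀ {a b} L → lt b a ≡ false → undo 0 (map (a ∷_) (map (b ∷_) L)) ≡ []
  undo-no-swap [] _ = refl
  undo-no-swap (x ∷ L) b⊀a rewrite b⊀a = undo-no-swap L b⊀a

  step-suffix : ∀ i x z → suc i < length x → step i (x ++ z) ≡ Maybe.map (_++ z) (step i x)
  step-suffix zero (a ∷ b ∷ x) z _ with lt b a
  ... | true = refl
  ... | false = refl
  step-suffix zero (a ∷ []) z (s≤s ())
  step-suffix (suc i) (a ∷ x) z (s≤s l) rewrite step-suffix i x z l with step i x
  ... | just _ = refl
  ... | nothing = refl

  undo-suffix : ∀ i z {L} → All (λ x → suc i < length x) L → undo i (map (_++ z) L) ≡ map (_++ z) (undo i L)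
  undo-suffix i z [] = refl
  undo-suffix i z {x ∷ L} (l ∷ al) rewrite step-suffix i x z l with step i x
  ... | just _ = cong (_ ∷_) (undo-suffix i z al)
  ... | nothing = undo-suffix i z al

  mixs-cons : ∀ c a o r V → mixs c (Maybe.map (λ (p′ , U′) → a ∷ p′ , U′) o) r V ≡ map (a ∷_) (mixs c o r V)
  mixs-cons c a nothing r V = refl
  mixs-cons c a (just (p , U)) r V = mix-prefix c (a ∷ []) p U r V

  drop-center : ∀ {i : ℕ} M (p F : Word) → suc i < length (p ++ M ∷ F) → i < length (p ++ F)
  drop-center {i} M p F l = ℕₚ.≤-pred (subst (suc i <_) (length-++-sucʳ p M F) l)

  -- In the crossing case i = length p, the members of the left branch in which c is followed
  -- by a letter that comes from w have an ascent at i, and the others are the left branch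
  -- for the new blocks.
  undo-mix : ∀ c i p U r V → All (_≺ c) p → Below _≺_ c U → Below (flip _≺_) c V → i < length (p ++ flat U) →
    undo i (mix c p U r V) ≡ mixs c (low i p U) r V

  -- There is a single member and no right branch. Writing its tail after `c` as `mix M p U r []`
  -- makes the induction hypothesis available.
  undo-mix-nil : ∀ c i M p U r → All (_≺ M) p → Below _≺_ M U → M ≺ c → i < length (p ++ M ∷ flat U) →
    undo i (map (c ∷_) (mix M p U r [])) ≡ mixs c (low i [] ((M , p) ∷ U)) r []
  undo-mix-nil c zero M [] U r p≺M b M≺c l = begin
    undo 0 (map (c ∷_) (mix M [] U r [])) ≡⟨ cong (λ z → undo 0 (map (c ∷_) z)) (mix-[] M [] U r) ⟩
    undo 0 (map (c ∷_) (map (M ∷_) ((flat U ++ reverse r) ∷ []))) ≡⟨ undo-swap _ M≺c ⟩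
    (M ∷ c ∷ flat U ++ reverse r) ∷ [] ≡⟨ mix-[] c (M ∷ []) U r ⟨
    mix c (M ∷ []) U r [] ∎
    where open ≡-Reasoning
  undo-mix-nil c zero M (a ∷ p) U r (a≺M ∷ _) b M≺c l = begin
    undo 0 (map (c ∷_) (mix M (a ∷ p) U r [])) ≡⟨ cong (λ z → undo 0 (map (c ∷_) z)) (mix-[] M (a ∷ p) U r) ⟩
    undo 0 (map (c ∷_) (map (a ∷_) (q ∷ []))) ≡⟨ undo-swap _ (lt-trans a≺M M≺c) ⟩
    (a ∷ c ∷ q) ∷ [] ≡⟨ cong (λ z → (a ∷ c ∷ z) ∷ []) (++-assoc p (M ∷ flat U) (reverse r)) ⟨
    mix c (a ∷ []) ((M , p) ∷ U) r [] ∎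
    where
    open ≡-Reasoning
    q = p ++ M ∷ flat U ++ reverse r
  undo-mix-nil c (suc i) M p U r p≺M b M≺c l = begin
    undo (suc i) (map (c ∷_) (mix M p U r [])) ≡⟨ undo-suc i c (mix M p U r []) ⟩
    map (c ∷_) (undo i (mix M p U r [])) ≡⟨ cong (map (c ∷_)) (undo-mix M i p U r [] p≺M b [] (drop-center M p (flat U) l)) ⟩
    map (c ∷_) (mixs M (low i p U) r []) ≡⟨ mixs-left (low i p U) ⟩
    mixs c (low (suc i) [] ((M , p) ∷ U)) r [] ∎
    where
    open ≡-Reasoning
    mixs-left : ∀ o → map (c ∷_) (mixs M o r []) ≡ mixs c (Maybe.map (λ (p′ , U′) → [] , (M , p′) ∷ U′) o) r []
    mixs-left nothing = refl
    mixs-left (just (p , U)) = trans (cong (map (c ∷_)) (mix-[] M p U r)) (sym (cong (λ z → (c ∷ z) ∷ []) (++-assoc p _ (reverse r))))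

  -- The letter after `a` is `c` or one that stands in its place; all of these lie above `a`, so
  -- there is no descent.
  undo-mix c zero (a ∷ []) U r V (a≺c ∷ _) b d l =
    trans (cong (undo 0) (mix-prefix c (a ∷ []) [] U r V))
          (undo-ascent a (mix-startsAbove c U r V a≺c (All.map (λ x → lt-trans a≺c x) (Below-flat (λ x y → lt-trans y x) d))))
  undo-mix c zero (x ∷ y ∷ p) U r V _ b d l
    rewrite mix-prefix c (x ∷ []) (y ∷ p) U r V | mix-prefix c (y ∷ []) p U r V with lt y x in e
  ... | true = trans (undo-swap (mix c p U r V) e) (sym (trans (mix-prefix c (y ∷ []) (x ∷ p) U r V) (cong (map (y ∷_)) (mix-prefix c (x ∷ []) p U r V))))
  ... | false = undo-no-swap (mix c p U r V) e
  undo-mix c (suc i) (a ∷ p) U r V (_ ∷ p≺c) b d (s≤s l) = begin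
    undo (suc i) (mix c (a ∷ p) U r V) ≡⟨ cong (undo (suc i)) (mix-prefix c (a ∷ []) p U r V) ⟩
    undo (suc i) (map (a ∷_) (mix c p U r V)) ≡⟨ undo-suc i a (mix c p U r V) ⟩
    map (a ∷_) (undo i (mix c p U r V)) ≡⟨ cong (map (a ∷_)) (undo-mix c i p U r V p≺c b d l) ⟩
    map (a ∷_) (mixs c (low i p U) r V) ≡⟨ mixs-cons c a (low i p U) r V ⟨
    mixs c (low (suc i) (a ∷ p) U) r V ∎
    where open ≡-Reasoning
  undo-mix c i [] [] r V _ b d ()
  undo-mix c i [] ((M , p) ∷ U) r [] _ (cons M≺c p≺M b) d l =
    trans (cong (undo i) eq) (undo-mix-nil c i M p U r p≺M b M≺c l)
    where
    eq : mix c [] ((M , p) ∷ U) r [] ≡ map (c ∷_) (mix M p U r [])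
    eq = sym (trans (cong (map (c ∷_)) (mix-[] M p U r)) (cong (λ z → (c ∷ z) ∷ []) (sym (++-assoc p (M ∷ flat U) (reverse r)))))
  -- The right branch is the induction hypothesis with `m` for `c`, since position `i` lies before
  -- the suffix; `rest` treats the left branch and joins the two.
  undo-mix c i [] U@((M , p) ∷ U′) r V@((m , r′) ∷ V′) _ b@(cons M≺c p≺M b′) (cons c≺m r≺m d) l = begin
    undo i (map (c ∷_) A ++ map (_++ s) B) ≡⟨ mapMaybe-++ (step i) (map (c ∷_) A) _ ⟩
    undo i (map (c ∷_) A) ++ undo i (map (_++ s) B)
      ≡⟨ cong (undo i (map (c ∷_) A) ++_) (trans (undo-suffix i s (All.map (ℕₚ.≤-<-trans l) (mix-nonempty m [] U r′ V′)))
           (cong (map (_++ s)) (undo-mix m i [] U r′ V′ [] (Below-weaken lt-trans b c≺m) d l))) ⟩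
    undo i (map (c ∷_) A) ++ map (_++ s) (mixs m (low i [] U) r′ V′) ≡⟨ rest i p U′ p≺M b′ l ⟩
    mixs c (low i [] U) r V ∎
    where
    open ≡-Reasoning
    A = mix M p U′ r V
    B = mix m [] U r′ V′
    s = reverse (r ++ c ∷ [])
    combine : ∀ o → map (c ∷_) (mixs M o r V) ++ map (_++ s) (mixs m (Maybe.map (λ (p′ , U′) → [] , (M , p′) ∷ U′) o) r′ V′)
      ≡ mixs c (Maybe.map (λ (p′ , U′) → [] , (M , p′) ∷ U′) o) r V
    combine nothing = refl
    combine (just _) = refl
    c≺V : All (c ≺_) (flat V)
    c≺V = Below-flat (λ x y → lt-trans y x) (cons c≺m r≺m d)
    rest : ∀ i p U′ → All (_≺ M) p → Below _≺_ M U′ → i < length (p ++ M ∷ flat U′) →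
      undo i (map (c ∷_) (mix M p U′ r V)) ++ map (_++ s) (mixs m (low i [] ((M , p) ∷ U′)) r′ V′)
      ≡ mixs c (low i [] ((M , p) ∷ U′)) r V
    rest zero (a ∷ p) U′ (a≺M ∷ _) b l =
      cong (_++ map (_++ s) (mix m (a ∷ []) ((M , p) ∷ U′) r′ V′))
        (trans (cong (λ z → undo 0 (map (c ∷_) z)) (mix-prefix M (a ∷ []) p U′ r V))
        (trans (undo-swap (mix M p U′ r V) (lt-trans a≺M M≺c)) (sym (map-∘ (mix M p U′ r V)))))
    -- In the one word of the left branch `c` is followed by a letter above it, so the expected
    -- member comes from the right branch alone.
    rest zero [] [] _ _ l = cong₂ _++_
      (undo-ascent c (subst (StartsAbove c) (cong reverse (++-assoc r (M ∷ r′) (m ∷ flat V′)))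
        (StartsAbove-reverse (r ++ M ∷ r′) m (flat V′) (Allₚ.++⁻ʳ r′ c≺V)) ∷ []))
      (cong (λ z → (M ∷ z) ∷ []) (trans (sym (reverse-++ (r ++ c ∷ []) (flat V))) (cong reverse (++-assoc r (c ∷ []) (flat V)))))
    -- The left branch splits once more; `c` is followed by `M` in the first half and by a letter
    -- above `c` in the second, so only the first half has a descent.
    rest zero [] U₂@((M₂ , p₂) ∷ U₃) _ _ l = cong (_++ map (_++ s) (mix m (M ∷ []) U₂ r′ V′)) (begin
      undo 0 (map (c ∷_) (map (M ∷_) A₂ ++ B₂)) ≡⟨ cong (undo 0) (map-++ (c ∷_) (map (M ∷_) A₂) B₂) ⟩
      undo 0 (map (c ∷_) (map (M ∷_) A₂) ++ map (c ∷_) B₂) ≡⟨ mapMaybe-++ (step 0) (map (c ∷_) (map (M ∷_) A₂)) _ ⟩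
      undo 0 (map (c ∷_) (map (M ∷_) A₂)) ++ undo 0 (map (c ∷_) B₂)
        ≡⟨ cong₂ _++_ (undo-swap A₂ M≺c) (undo-ascent c (Allₚ.map⁺ (All.map (λ {x} → StartsAbove-++ {x = x})
             (mix-startsAbove m U₂ r′ V′ c≺m (All.tail (Allₚ.++⁻ʳ r′ c≺V)))))) ⟩
      map (M ∷_) (map (c ∷_) A₂) ++ [] ≡⟨ ++-identityʳ _ ⟩
      map (M ∷_) (map (c ∷_) A₂) ≡⟨ map-∘ A₂ ⟨
      map ((M ∷ c ∷ []) ++_) A₂ ∎)
      where
      A₂ = mix M₂ p₂ U₃ r V
      B₂ = map (_++ reverse (r ++ M ∷ [])) (mix m [] U₂ r′ V′)
    rest (suc i) p U′ p≺M b l = trans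
      (cong (_++ map (_++ s) (mixs m (low (suc i) [] ((M , p) ∷ U′)) r′ V′))
        (trans (undo-suc i c (mix M p U′ r V)) (cong (map (c ∷_)) (undo-mix M i p U′ r V p≺M b (cons (lt-trans M≺c c≺m) r≺m d) (drop-center M p (flat U′) l)))))
      (combine (low i p U′))

  low-length : ∀ i p U {p′ U′} → low i p U ≡ just (p′ , U′) → length (p′ ++ flat U′) ≡ length (p ++ flat U)
  low-length zero [] ((M , []) ∷ U) refl = refl
  low-length zero [] ((M , x ∷ p) ∷ U) refl = refl
  low-length (suc i) [] ((M , p) ∷ U) eq with low i p U in e
  low-length (suc i) [] ((M , p) ∷ U) refl | just (p′ , U′) = begin
    length (p′ ++ M ∷ flat U′) ≡⟨ length-++-sucʳ p′ M (flat U′) ⟩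
    suc (length (p′ ++ flat U′)) ≡⟨ cong suc (low-length i p U e) ⟩
    suc (length (p ++ flat U)) ≡⟨ length-++-sucʳ p M (flat U) ⟨
    length (p ++ M ∷ flat U) ∎
    where open ≡-Reasoning
  low-length zero (x ∷ y ∷ p) U eq with lt y x
  low-length zero (x ∷ y ∷ p) U refl | true = refl
  low-length (suc i) (x ∷ p) U eq with low i p U in e
  low-length (suc i) (x ∷ p) U refl | just _ = cong suc (low-length i p U e)

  -- If the second word is `c` alone, the mix is the single word `p ++ c ∷ flat U`, and `undo-mix`
  -- specialises to a statement about that word.
  step-blocks : ∀ {c} i p U → All (_≺ c) p → Below _≺_ c U → i < length (p ++ flat U) →
    step i (p ++ c ∷ flat U) ≡ Maybe.map (λ (p′ , U′) → p′ ++ c ∷ flat U′) (low i p U)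
  step-blocks {c} i p U p≺c b l
    with step i (p ++ c ∷ flat U) | low i p U
       | subst (λ z → undo i z ≡ mixs c (low i p U) [] []) (mix-[][] c p U) (undo-mix c i p U [] [] p≺c b [] l)
  ... | nothing | nothing | _ = refl
  ... | nothing | just (p′ , U′) | e = contradiction (trans e (mix-[][] c p′ U′)) λ ()
  ... | just _ | nothing | ()
  ... | just _ | just (p′ , U′) | e = cong just (∷-injectiveˡ (trans e (mix-[][] c p′ U′)))

  step-split : ∀ a x y b → step (length a) (a ++ x ∷ y ∷ b) ≡ (if lt y x then just (a ++ y ∷ x ∷ b) else nothing)
  step-split [] x y b = refl
  step-split (z ∷ a) x y b rewrite step-split a x y b with lt y x
  ... | true = refl
  ... | false = refl

  step-none : ∀ i π → length π ≤ suc i → step i π ≡ nothing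
  step-none zero [] _ = refl
  step-none zero (a ∷ []) _ = refl
  step-none zero (a ∷ b ∷ π) (s≤s ())
  step-none (suc i) [] _ = refl
  step-none (suc i) (a ∷ π) (s≤s l) rewrite step-none i π l = refl

  module _ (lt-total : ∀ {a b} → a ≢ b → lt a b ≡ false → lt b a ≡ true) where

    -- Read from the right: a letter below the first maximum found so far joins its segment, any
    -- other letter opens a new block.
    blocks-exist : ∀ c s → Unique s → All (_≺ c) s → ∃ λ U → flat U ≡ s × Below _≺_ c U
    blocks-exist c [] _ _ = [] , refl , []
    blocks-exist c (x ∷ s) (x≢ ∷ un) (x≺c ∷ al) with blocks-exist c s un al
    ... | [] , refl , _ = (x , []) ∷ [] , refl , cons x≺c [] []
    ... | (M , p) ∷ U , refl , cons M≺c p≺M b with lt x M in e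
    ... | true = (M , x ∷ p) ∷ U , refl , cons M≺c (e ∷ p≺M) b
    ... | false = (x , []) ∷ (M , p) ∷ U , refl , cons x≺c [] (cons (lt-total (All.lookup x≢ (∈-insert p)) e) p≺M b)

    decompose : ∀ {c s t} → s ↭ c ∷ t → Unique t → All (_≺ c) t →
      ∃₂ λ p U → s ≡ p ++ c ∷ flat U × All (_≺ c) p × Below _≺_ c U
    decompose {c} q un t≺c with ∈-∃++ (∈-resp-↭ (↭-sym q) (here refl))
    ... | p , s , refl with drop-mid p [] q
    ... | e with All-resp-↭ (↭-sym e) t≺c
    ... | al with blocks-exist c s (subst Unique (drop-length p s) (Uniqueₚ.drop⁺ (length p) (Unique-resp-↭ (↭-sym e) un))) (Allₚ.++⁻ʳ p al)
    ... | U , refl , b = p , U , refl , Allₚ.++⁻ˡ p al , b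

-- Counting

<ᵇ-true : ∀ {a b} → a < b → (a <ᵇ b) ≡ true
<ᵇ-true l = Equivalence.to T-≡ (ℕₚ.<⇒<ᵇ l)

<ᵇ-true⁻ : ∀ {a b} → (a <ᵇ b) ≡ true → a < b
<ᵇ-true⁻ {a} {b} e = ℕₚ.<ᵇ⇒< a b (Equivalence.from T-≡ e)

<ᵇ-false : ∀ {a b} → b ≤ a → (a <ᵇ b) ≡ false
<ᵇ-false l = ¬-not (λ e → ℕₚ.<⇒≱ (<ᵇ-true⁻ e) l)

<ᵇ-false⁻ : ∀ {a b} → (a <ᵇ b) ≡ false → b ≤ a
<ᵇ-false⁻ {a} {b} e = ℕₚ.≮⇒≥ (λ l → case trans (sym e) (<ᵇ-true l) of λ ())

≡ᵇ-true⁻ : ∀ {a b} → (a ≡ᵇ b) ≡ true → a ≡ b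
≡ᵇ-true⁻ {a} {b} e = ℕₚ.≡ᵇ⇒≡ a b (Equivalence.from T-≡ e)

≡ᵇ-refl : ∀ a → (a ≡ᵇ a) ≡ true
≡ᵇ-refl a = Equivalence.to T-≡ (ℕₚ.≡⇒≡ᵇ a a refl)

≡ᵇ-false : ∀ {a b} → a ≢ b → (a ≡ᵇ b) ≡ false
≡ᵇ-false a≢b = ¬-not (a≢b ∘ ≡ᵇ-true⁻)

==ᵂ-true⁻ : ∀ {x y} → (x ==ᵂ y) ≡ true → x ≡ y
==ᵂ-true⁻ {[]} {[]} _ = refl
==ᵂ-true⁻ {a ∷ x} {b ∷ y} e with a ≡ᵇ b in e₁
... | true = cong₂ _∷_ (≡ᵇ-true⁻ e₁) (==ᵂ-true⁻ e)

==ᵂ-refl : ∀ x → (x ==ᵂ x) ≡ true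
==ᵂ-refl [] = refl
==ᵂ-refl (a ∷ x) rewrite ≡ᵇ-refl a = ==ᵂ-refl x

==ᵂ-false : ∀ {x y} → x ≢ y → (x ==ᵂ y) ≡ false
==ᵂ-false x≢y = ¬-not (x≢y ∘ ==ᵂ-true⁻)

total : ∀ {A : Set} → (A → ℕ) → List A → ℕ
total f L = sum (map f L)

total-++ : ∀ {A : Set} (f : A → ℕ) L M → total f (L ++ M) ≡ total f L + total f M
total-++ f L M = trans (cong sum (map-++ f L M)) (sum-++ (map f L) (map f M))

total-map : ∀ {A B : Set} (f : B → ℕ) (g : A → B) L → total f (map g L) ≡ total (f ∘ g) L
total-map f g L = cong sum (sym (map-∘ L))

total-concatMap : ∀ {A B : Set} (f : B → ℕ) (g : A → List B) L → total f (concatMap g L) ≡ total (total f ∘ g) L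
total-concatMap f g [] = refl
total-concatMap f g (x ∷ L) = trans (total-++ f (g x) (concatMap g L)) (cong (total f (g x) +_) (total-concatMap f g L))

total-cong : ∀ {A : Set} {f g : A → ℕ} {L} → All (λ x → f x ≡ g x) L → total f L ≡ total g L
total-cong al = cong sum (map-cong-local al)

total-mapMaybe : ∀ {A B : Set} (f : B → ℕ) (g : A → Maybe B) L → total f (mapMaybe g L) ≡ total (maybe′ f 0 ∘ g) L
total-mapMaybe f g [] = refl
total-mapMaybe f g (x ∷ L) with g x
... | just y = cong (f y +_) (total-mapMaybe f g L)
... | nothing = total-mapMaybe f g L

total-*ˡ : ∀ {A : Set} k (f : A → ℕ) L → total (λ x → k * f x) L ≡ k * total f L
total-*ˡ k f [] = sym (ℕₚ.*-zeroʳ k)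
total-*ˡ k f (x ∷ L) = trans (cong (k * f x +_) (total-*ˡ k f L)) (sym (ℕₚ.*-distribˡ-+ k (f x) (total f L)))

total-*ʳ : ∀ {A : Set} k (f : A → ℕ) L → total (λ x → f x * k) L ≡ total f L * k
total-*ʳ k f L = trans (total-cong (All.universal (λ x → ℕₚ.*-comm (f x) k) L)) (trans (total-*ˡ k f L) (ℕₚ.*-comm k _))

total-zero : ∀ {A : Set} {f : A → ℕ} {L} → All (λ x → f x ≡ 0) L → total f L ≡ 0
total-zero [] = refl
total-zero (e ∷ al) rewrite e = total-zero al

bool : Bool → ℕ
bool b = if b then 1 else 0

length-filterᵇ : ∀ {A : Set} (p : A → Bool) L → length (filterᵇ p L) ≡ total (bool ∘ p) L
length-filterᵇ p [] = refl
length-filterᵇ p (x ∷ L) with p x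
... | true = cong suc (length-filterᵇ p L)
... | false = length-filterᵇ p L

total-filterᵇ : ∀ {A : Set} (f : A → ℕ) (p : A → Bool) L → total f (filterᵇ p L) ≡ total (λ x → if p x then f x else 0) L
total-filterᵇ f p [] = refl
total-filterᵇ f p (x ∷ L) with p x
... | true = cong (f x +_) (total-filterᵇ f p L)
... | false = total-filterᵇ f p L

δ : Word → Word → ℕ
δ x y = bool (x ==ᵂ y)

δ-refl : ∀ x → δ x x ≡ 1
δ-refl x = cong bool (==ᵂ-refl x)

δ-≢ : ∀ {x y} → x ≢ y → δ x y ≡ 0
δ-≢ n = cong bool (==ᵂ-false n)

δ-cases : ∀ x y → (x ≡ y) ⊎ (x ≢ y)
δ-cases x y with x ==ᵂ y in e
... | true = inj₁ (==ᵂ-true⁻ e)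
... | false = inj₂ λ { refl → case trans (sym e) (==ᵂ-refl x) of λ () }

bool-∧ : ∀ a b → bool (a ∧ b) ≡ bool a * bool b
bool-∧ true b = sym (ℕₚ.*-identityˡ _)
bool-∧ false b = refl

<ᵇ-asym : ∀ a b → (a <ᵇ b) ≡ true → (b <ᵇ a) ≡ false
<ᵇ-asym a b e = <ᵇ-false (ℕₚ.<⇒≤ (<ᵇ-true⁻ {a} {b} e))

<ᵇ-trans : ∀ a b c → (a <ᵇ b) ≡ true → (b <ᵇ c) ≡ true → (a <ᵇ c) ≡ true
<ᵇ-trans a b c e f = <ᵇ-true (ℕₚ.<-trans (<ᵇ-true⁻ {a} {b} e) (<ᵇ-true⁻ {b} {c} f))

-- The first word uses the usual order; the second one, which is reversed, the opposite order.
module Std = Order _<ᵇ_ (λ {a} {b} → <ᵇ-asym a b) (λ {a} {b} {c} → <ᵇ-trans a b c)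
module Opp = Order (flip _<ᵇ_) (λ {a} {b} → <ᵇ-asym b a) (λ {a} {b} {c} e f → <ᵇ-trans c b a f e)

open Std using (step)

-- Inversions, descents and reduced words

-- The number (0 or 1) of ways to get from π to t by undoing the descents at the letters of y
-- in turn; y is a reduced word read backwards, and letter suc i is 0-based position i.
paths : Word → Word → Word → ℕ
paths t [] π = δ π t
paths t (zero ∷ y) π = 0
paths t (suc i ∷ y) π = maybe′ (paths t y) 0 (step i π)

-- The count behind `fl` and `orderMap`; in `inv` it is the number of inversions that a letter forms
-- with those after it.
rank : ℕ → Word → ℕ
rank x xs = length (filterᵇ (_<ᵇ x) xs)

rank-↭ : ∀ x {xs ys} → xs ↭ ys → rank x xs ≡ rank x ys
rank-↭ x p = ↭-length (filter-↭ _ p)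

swapAt-↭ : ∀ i π → swapAt i π ↭ π
swapAt-↭ zero π = ↭-refl
swapAt-↭ (suc zero) [] = ↭-refl
swapAt-↭ (suc zero) (a ∷ []) = ↭-refl
swapAt-↭ (suc zero) (a ∷ b ∷ π) = swap b a ↭-refl
swapAt-↭ (suc (suc i)) [] = ↭-refl
swapAt-↭ (suc (suc i)) (a ∷ π) = prep a (swapAt-↭ (suc i) π)

swapAt-involutive : ∀ i π → swapAt i (swapAt i π) ≡ π
swapAt-involutive zero π = refl
swapAt-involutive (suc zero) [] = refl
swapAt-involutive (suc zero) (a ∷ []) = refl
swapAt-involutive (suc zero) (a ∷ b ∷ π) = refl
swapAt-involutive (suc (suc i)) [] = refl
swapAt-involutive (suc (suc i)) (a ∷ π) = cong (a ∷_) (swapAt-involutive (suc i) π)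

inv : Word → ℕ
inv [] = 0
inv (x ∷ xs) = rank x xs + inv xs

rank-cons-< : ∀ {x y} ys → y < x → rank x (y ∷ ys) ≡ suc (rank x ys)
rank-cons-< ys y<x rewrite <ᵇ-true y<x = refl

rank-cons-≥ : ∀ {x y} ys → x ≤ y → rank x (y ∷ ys) ≡ rank x ys
rank-cons-≥ ys x≤y rewrite <ᵇ-false x≤y = refl

inv-swap : ∀ {a b} xs → b < a → inv (a ∷ b ∷ xs) ≡ suc (inv (b ∷ a ∷ xs))
inv-swap {a} {b} xs b<a rewrite rank-cons-< xs b<a | rank-cons-≥ {b} {a} xs (ℕₚ.<⇒≤ b<a) = cong suc (begin
  rank a xs + (rank b xs + inv xs) ≡⟨ ℕₚ.+-assoc (rank a xs) _ _ ⟨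
  (rank a xs + rank b xs) + inv xs ≡⟨ cong (_+ inv xs) (ℕₚ.+-comm (rank a xs) (rank b xs)) ⟩
  (rank b xs + rank a xs) + inv xs ≡⟨ ℕₚ.+-assoc (rank b xs) _ _ ⟩
  rank b xs + (rank a xs + inv xs) ∎)
  where open ≡-Reasoning

if-just : ∀ {A : Set} {x y : A} b → (if b then just x else nothing) ≡ just y → b ≡ true × x ≡ y
if-just true refl = refl , refl

-- Inversions serve as a countdown: every successful `step` uses up exactly one.
step-swap : ∀ i π {π′} → step i π ≡ just π′ → π′ ≡ swapAt (suc i) π × inv π ≡ suc (inv π′)
step-swap zero (a ∷ b ∷ π) e with if-just (b <ᵇ a) e
... | lt , refl = refl , inv-swap π (<ᵇ-true⁻ {b} {a} lt)
step-swap (suc i) (a ∷ π) e with step i π in e′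
step-swap (suc i) (a ∷ π) refl | just π′ with step-swap i π e′
... | refl , q = refl , (begin
  rank a π + inv π ≡⟨ cong₂ _+_ (rank-↭ a (↭-sym (swapAt-↭ (suc i) π))) q ⟩
  rank a π′ + suc (inv π′) ≡⟨ ℕₚ.+-suc _ _ ⟩
  suc (rank a π′ + inv π′) ∎)
  where open ≡-Reasoning

-- A simple transposition either creates a descent, which `step` undoes, or gains no inversion.
-- Positions outside the word fall under the second alternative.
swap-cases : ∀ i π → step i (swapAt (suc i) π) ≡ just π ⊎ inv (swapAt (suc i) π) ≤ inv π
swap-cases zero [] = inj₂ z≤n
swap-cases zero (a ∷ []) = inj₂ z≤n
swap-cases zero (a ∷ b ∷ π) with ℕₚ.<-cmp a b
... | tri< a<b _ _ = inj₁ (cong (λ z → if z then just (a ∷ b ∷ π) else nothing) (<ᵇ-true a<b))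
... | tri≈ _ refl _ = inj₂ ℕₚ.≤-refl
... | tri> _ _ b<a = inj₂ (ℕₚ.≤-trans (ℕₚ.n≤1+n _) (ℕₚ.≤-reflexive (sym (inv-swap π b<a))))
swap-cases (suc i) [] = inj₂ z≤n
swap-cases (suc i) (a ∷ π) with swap-cases i π
... | inj₁ e rewrite e = inj₁ refl
... | inj₂ l = inj₂ (ℕₚ.+-mono-≤ (ℕₚ.≤-reflexive (rank-↭ a (swapAt-↭ (suc i) π))) l)

InRange : ℕ → ℕ → Set
InRange n i = 1 ≤ i × i ≤ n

step-length : ∀ i π {π′} → step i π ≡ just π′ → suc i < length π
step-length zero (a ∷ b ∷ π) _ = s≤s (s≤s z≤n)
step-length (suc i) (a ∷ π) e with step i π in e′
... | just _ = s≤s (step-length i π e′)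

-- On the reversed word the left fold `evalWord` becomes a right fold, whose head is the
-- transposition applied last and undone first.
evalRev : ℕ → Word → Word
evalRev n = foldr swapAt (range1 (suc n))

evalWord-reverse : ∀ n x → evalWord n x ≡ evalRev n (reverse x)
evalWord-reverse n x = sym (reverse-foldr swapAt (range1 (suc n)) x)

range1-applyUpTo : ∀ n → range1 n ≡ applyUpTo suc n
range1-applyUpTo n = map-upTo suc n

length-range1 : ∀ n → length (range1 n) ≡ n
length-range1 n = trans (length-map suc (upTo n)) (length-upTo n)

range1-increasing : ∀ n → AllPairs _<_ (range1 n)
range1-increasing n = subst (AllPairs _<_) (sym (range1-applyUpTo n)) (AllPairsₚ.applyUpTo⁺₁ suc n (λ i<j _ → s≤s i<j))

range1-InRange : ∀ n → All (InRange n) (range1 n)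
range1-InRange n = subst (All (InRange n)) (sym (range1-applyUpTo n)) (Allₚ.applyUpTo⁺₁ suc n (λ l → s≤s z≤n , l))

rank-none : ∀ {x xs} → All (x ≤_) xs → rank x xs ≡ 0
rank-none [] = refl
rank-none {x} (_∷_ {x = y} {xs} l al) = trans (rank-cons-≥ xs l) (rank-none al)

inv-sorted : ∀ {xs} → AllPairs _<_ xs → inv xs ≡ 0
inv-sorted [] = refl
inv-sorted (al ∷ s) = cong₂ _+_ (rank-none (All.map ℕₚ.<⇒≤ al)) (inv-sorted s)

evalRev-↭ : ∀ n y → evalRev n y ↭ range1 (suc n)
evalRev-↭ n [] = ↭-refl
evalRev-↭ n (i ∷ y) = ↭-trans (swapAt-↭ i (evalRev n y)) (evalRev-↭ n y)

-- A letter adds at most one inversion, so no word for a permutation is shorter than its inversion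
-- number.
inv-evalRev : ∀ n y → inv (evalRev n y) ≤ length y
inv-evalRev n [] = ℕₚ.≤-reflexive (inv-sorted (range1-increasing (suc n)))
inv-evalRev n (zero ∷ y) = ℕₚ.m≤n⇒m≤1+n (inv-evalRev n y)
inv-evalRev n (suc i ∷ y) with swap-cases i (evalRev n y)
... | inj₁ e = ℕₚ.≤-trans (ℕₚ.≤-reflexive (proj₂ (step-swap i _ e))) (s≤s (inv-evalRev n y))
... | inj₂ l = ℕₚ.m≤n⇒m≤1+n (ℕₚ.≤-trans l (inv-evalRev n y))

-- Here `inv` stands in for the minimal length; `reducedWords-inv` justifies this.
Minimal : ℕ → Word → Word → Set
Minimal n y π = evalRev n y ≡ π × length y ≡ inv π

-- A word of length `inv π` cannot afford a letter that gains no inversion, so each letter creates a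
-- descent and the path never breaks off.
paths-minimal : ∀ n y π → Minimal n y π → paths (range1 (suc n)) y π ≡ 1
paths-minimal n [] _ (refl , _) = δ-refl (range1 (suc n))
paths-minimal n (zero ∷ y) _ (refl , l) = contradiction (ℕₚ.≤-trans (ℕₚ.≤-reflexive l) (inv-evalRev n y)) ℕₚ.1+n≰n
paths-minimal n (suc i ∷ y) _ (refl , l) with swap-cases i (evalRev n y)
... | inj₁ e rewrite e = paths-minimal n y _ (refl , ℕₚ.suc-injective (trans l (proj₂ (step-swap i _ e))))
... | inj₂ le = contradiction (ℕₚ.≤-trans (ℕₚ.≤-reflexive l) (ℕₚ.≤-trans le (inv-evalRev n y))) ℕₚ.1+n≰n

-- A surviving path loses one inversion per letter and ends at the identity, so the word is minimal;
-- descents exist only inside the permutation, which bounds the letters.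
paths-cases : ∀ n y π → length π ≡ suc n → paths (range1 (suc n)) y π ≡ 0 ⊎ (Minimal n y π × All (InRange n) y)
paths-cases n [] π l with δ-cases π (range1 (suc n))
... | inj₁ refl = inj₂ ((refl , sym (inv-sorted (range1-increasing (suc n)))) , [])
... | inj₂ ne = inj₁ (δ-≢ ne)
paths-cases n (zero ∷ y) π l = inj₁ refl
paths-cases n (suc i ∷ y) π l with step i π in e
... | nothing = inj₁ refl
... | just π′ with step-swap i π e
... | refl , q with paths-cases n y π′ (trans (↭-length (swapAt-↭ (suc i) π)) l)
... | inj₁ z = inj₁ z
... | inj₂ ((ev , len) , al) = inj₂ ((trans (cong (swapAt (suc i)) ev) (swapAt-involutive (suc i) π) , trans (cong suc len) (sym q))
   , (s≤s z≤n , ℕₚ.≤-pred (subst (suc i <_) l (step-length i π e))) ∷ al)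

descent⊎sorted : ∀ π → (∃₂ λ i π′ → step i π ≡ just π′) ⊎ Linked _≤_ π
descent⊎sorted [] = inj₂ []
descent⊎sorted (a ∷ []) = inj₂ [-]
descent⊎sorted (a ∷ b ∷ π) with descent⊎sorted (b ∷ π) | b <ᵇ a in lt
... | _ | true = inj₁ (0 , b ∷ a ∷ π , cong (λ z → if z then just (b ∷ a ∷ π) else nothing) lt)
... | inj₁ (i , π′ , e) | false = inj₁ (suc i , a ∷ π′ , cong (Maybe.map (a ∷_)) e)
... | inj₂ s | false = inj₂ (<ᵇ-false⁻ lt ∷ s)

sorted-unique : ∀ {xs ys} → Linked _≤_ xs → Linked _≤_ ys → xs ↭ ys → xs ≡ ys
sorted-unique s t p = Pointwise-≡⇒≡ (Sortedₚ.↗↭↗⇒≋ ℕₚ.≤-totalOrder s t (↭⇒↭ₛ p))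

range1-sorted : ∀ n → Linked _≤_ (range1 n)
range1-sorted n = Sortedₚ.AllPairs⇒Sorted ℕₚ.≤-totalOrder (AllPairs.map ℕₚ.<⇒≤ (range1-increasing n))

-- Induction on the number of inversions: a permutation without descents is sorted, hence the
-- identity.
minimal-exists : ∀ n π → π ↭ range1 (suc n) → ∃ λ y → Minimal n y π × All (InRange n) y
minimal-exists n π = go (inv π) π refl
  where
  go : ∀ k π → inv π ≡ k → π ↭ range1 (suc n) → ∃ λ y → Minimal n y π × All (InRange n) y
  go k π e p with descent⊎sorted π
  ... | inj₂ s rewrite sorted-unique s (range1-sorted (suc n)) p =
    [] , (refl , sym (inv-sorted (range1-increasing (suc n)))) , []
  go zero π e p | inj₁ (i , π′ , d) = contradiction (trans (sym e) (proj₂ (step-swap i π d))) λ ()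
  go (suc k) π e p | inj₁ (i , π′ , d) with step-swap i π d
  ... | refl , q with go k π′ (ℕₚ.suc-injective (trans (sym q) e)) (↭-trans (swapAt-↭ (suc i) π) p)
  ... | y , (ev , len) , al = suc i ∷ y , (trans (cong (swapAt (suc i)) ev) (swapAt-involutive (suc i) π) , trans (cong suc len) (sym q))
    , (s≤s z≤n , ℕₚ.≤-pred (subst (suc i <_) (trans (↭-length p) (length-range1 (suc n))) (step-length i π d))) ∷ al

-- Shows that the search range of `reducedWords` is long enough.
inv-bound : ∀ n π → length π ≡ suc n → inv π ≤ n * n
inv-bound zero (x ∷ []) _ = z≤n
inv-bound (suc n) (x ∷ π) l = ℕₚ.+-mono-≤ {rank x π} {suc n}
  (ℕₚ.≤-trans (length-filter _ π) (ℕₚ.≤-reflexive (ℕₚ.suc-injective l)))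
  (ℕₚ.≤-trans (inv-bound n π (ℕₚ.suc-injective l)) (ℕₚ.*-monoʳ-≤ n (ℕₚ.n≤1+n n)))

-- Multiplicities in the list of reduced words

χ : Word → List Word → ℕ
χ x = total (δ x)

occurrences : ℕ → List ℕ → ℕ
occurrences i = total (λ j → bool (i ≡ᵇ j))

χ-map-∷ : ∀ i j x W → χ (i ∷ x) (map (j ∷_) W) ≡ bool (i ≡ᵇ j) * χ x W
χ-map-∷ i j x W = trans (total-map (δ (i ∷ x)) (j ∷_) W)
  (trans (total-cong (All.universal (λ z → bool-∧ (i ≡ᵇ j) (x ==ᵂ z)) W)) (total-*ˡ (bool (i ≡ᵇ j)) (δ x) W))

χ-cons : ∀ i x js W → χ (i ∷ x) (concatMap (λ j → map (j ∷_) W) js) ≡ occurrences i js * χ x W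
χ-cons i x js W = begin
  χ (i ∷ x) (concatMap (λ j → map (j ∷_) W) js) ≡⟨ total-concatMap (δ (i ∷ x)) _ js ⟩
  total (λ j → χ (i ∷ x) (map (j ∷_) W)) js ≡⟨ total-cong (All.universal (λ j → χ-map-∷ i j x W) js) ⟩
  total (λ j → bool (i ≡ᵇ j) * χ x W) js ≡⟨ total-*ʳ (χ x W) _ js ⟩
  occurrences i js * χ x W ∎
  where open ≡-Reasoning

occurrences-range1 : ∀ {n i} → InRange n i → occurrences i (range1 n) ≡ 1
occurrences-range1 {n} {suc i} (_ , i<n) = trans (total-map (λ j → bool (suc i ≡ᵇ j)) suc (upTo n)) (go (λ j → j) (λ e → e) n i i<n)
  where
  -- Generalised to an injective `f`, because `applyUpTo` composes its function with `suc` at each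
  -- step.
  go : ∀ (f : ℕ → ℕ) → (∀ {a b} → f a ≡ f b → a ≡ b) → ∀ n i → i < n → occurrences (f i) (applyUpTo f n) ≡ 1
  go f inj (suc n) zero _ rewrite ≡ᵇ-refl (f 0) = cong suc (total-zero (Allₚ.applyUpTo⁺₁ (f ∘ suc) n
    (λ {j} _ → cong bool (≡ᵇ-false {f 0} {f (suc j)} (λ e → case inj e of λ ())))))
  go f inj (suc n) (suc i) (s≤s l) rewrite ≡ᵇ-false {f (suc i)} {f 0} (λ e → case inj e of λ ()) =
    go (f ∘ suc) (λ e → ℕₚ.suc-injective (inj e)) n i l

χ-wordsOfLength : ∀ n x → All (InRange n) x → χ x (wordsOfLength n (length x)) ≡ 1
χ-wordsOfLength n [] _ = refl
χ-wordsOfLength n (i ∷ x) (r ∷ al) = trans (χ-cons i x (range1 n) (wordsOfLength n (length x)))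
  (cong₂ _*_ (occurrences-range1 r) (χ-wordsOfLength n x al))

WordOf : ℕ → ℕ → Word → Set
WordOf n L x = length x ≡ L × All (InRange n) x

wordsOfLength-all : ∀ n L → All (WordOf n L) (wordsOfLength n L)
wordsOfLength-all n zero = (refl , []) ∷ []
wordsOfLength-all n (suc L) = Allₚ.concat⁺ (Allₚ.map⁺ (All.map
  (λ r → Allₚ.map⁺ (All.map (λ (l , al) → cong suc l , r ∷ al) (wordsOfLength-all n L))) (range1-InRange n)))

firstNonEmpty-applyUpTo : ∀ h K L → L < K → (∀ {l} → l < L → h l ≡ []) → h L ≢ [] → firstNonEmpty (applyUpTo h K) ≡ h L
firstNonEmpty-applyUpTo h (suc K) zero _ _ ne with h 0
... | [] = contradiction refl ne
... | _ ∷ _ = refl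
firstNonEmpty-applyUpTo h (suc K) (suc L) (s≤s l) z ne rewrite z {0} (s≤s z≤n) =
  firstNonEmpty-applyUpTo (h ∘ suc) K L l (λ q → z (s≤s q)) ne

χ-filterᵇ : ∀ x p W → χ x (filterᵇ p W) ≡ bool (p x) * χ x W
χ-filterᵇ x p W = trans (total-filterᵇ (δ x) p W) (trans (total-cong (All.universal h W)) (total-*ˡ (bool (p x)) (δ x) W))
  where
  h : ∀ z → (if p z then δ x z else 0) ≡ bool (p x) * δ x z
  h z with δ-cases x z
  h z | inj₂ ne rewrite δ-≢ ne | ℕₚ.*-zeroʳ (bool (p x)) with p z
  ... | true = refl
  ... | false = refl
  h z | inj₁ refl rewrite δ-refl x with p x
  ... | true = refl
  ... | false = refl

wordsWithProduct-all : ∀ n π L → All (λ x → WordOf n L x × evalWord n x ≡ π) (wordsWithProduct n π L)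
wordsWithProduct-all n π L = All.zip (Allₚ.filter⁺ _ (wordsOfLength-all n L) ,
  All.map (λ t → ==ᵂ-true⁻ (Equivalence.to T-≡ t)) (Allₚ.all-filter _ (wordsOfLength n L)))

minimal-reverse : ∀ n x π → Minimal n (reverse x) π → evalWord n x ≡ π × length x ≡ inv π
minimal-reverse n x π (e , l) = trans (evalWord-reverse n x) e , trans (sym (length-reverse x)) l

χ-minimal : ∀ n x π → evalWord n x ≡ π → length x ≡ inv π → All (InRange n) x → χ x (wordsWithProduct n π (inv π)) ≡ 1
χ-minimal n x _ refl l al rewrite sym l = trans (χ-filterᵇ x _ (wordsOfLength n (length x)))
  (cong₂ _*_ (cong bool (==ᵂ-refl (evalWord n x))) (χ-wordsOfLength n x al))

-- No word for `π` is shorter than `inv π` and one of that length exists, so the upward search stops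
-- exactly there.
reducedWords-inv : ∀ n π → π ↭ range1 (suc n) → reducedWords n π ≡ wordsWithProduct n π (inv π)
reducedWords-inv n π p = trans (cong firstNonEmpty (map-upTo (wordsWithProduct n π) (suc (n * n))))
  (firstNonEmpty-applyUpTo (wordsWithProduct n π) (suc (n * n)) (inv π)
    (s≤s (inv-bound n π (trans (↭-length p) (length-range1 (suc n))))) short nonempty)
  where
  short : ∀ {L} → L < inv π → wordsWithProduct n π L ≡ []
  short {L} lt with wordsWithProduct n π L | wordsWithProduct-all n π L
  ... | [] | _ = refl
  ... | x ∷ _ | ((refl , _) , refl) ∷ _ = contradiction lt (ℕₚ.≤⇒≯
    (subst₂ _≤_ (cong inv (sym (evalWord-reverse n x))) (length-reverse x) (inv-evalRev n (reverse x))))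
  nonempty : wordsWithProduct n π (inv π) ≢ []
  nonempty e with minimal-exists n π p
  ... | y , mn , al with minimal-reverse n (reverse y) π (subst (λ z → Minimal n z π) (sym (reverse-involutive y)) mn)
  ... | e′ , l = contradiction (trans (sym (χ-minimal n (reverse y) π e′ l (All-resp-↭ (↭-sym (↭-reverse y)) al))) (cong (χ (reverse y)) e)) λ ()

-- Replaces the search by a count that proceeds letter by letter: both sides are 1 for minimal words
-- and 0 otherwise.
χ-reducedWords : ∀ n x π → π ↭ range1 (suc n) → χ x (reducedWords n π) ≡ paths (range1 (suc n)) (reverse x) π
χ-reducedWords n x π p rewrite reducedWords-inv n π p with paths-cases n (reverse x) π (trans (↭-length p) (length-range1 (suc n)))
... | inj₂ (mn , al) with minimal-reverse n x π mn
... | e , l = trans (χ-minimal n x π e l (All-resp-↭ (↭-reverse x) al)) (sym (paths-minimal n (reverse x) π mn))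
χ-reducedWords n x π p | inj₁ z = trans (total-zero (All.map (λ q → δ-≢ (absent q)) (wordsWithProduct-all n π (inv π)))) (sym z)
  where
  absent : ∀ {y} → WordOf n (inv π) y × evalWord n y ≡ π → x ≢ y
  absent ((l , _) , e) refl = contradiction
    (trans (sym z) (paths-minimal n (reverse x) π (trans (sym (evalWord-reverse n x)) e , trans (length-reverse x) l))) λ ()

-- Coefficients of a mix

lows : ℕ → Word → Word
lows m = filterᵇ (_<ᵇ suc m)

highLetters : ℕ → Word → Word
highLetters m = filterᵇ (λ z → not (z <ᵇ suc m))

highs : ℕ → Word → Word
highs m y = map (_∸ m) (highLetters m y)

total-↭ : ∀ {A : Set} (f : A → ℕ) {L M} → L ↭ M → total f L ≡ total f M
total-↭ f p = sum-↭ (↭-map⁺ f p)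

total-mirror : ∀ (f : Word → ℕ) c p U r V → total f (mix c p U r V) ≡ total (f ∘ reverse) (mix c r V p U)
total-mirror f c p U r V = begin
  total f (mix c p U r V) ≡⟨ total-cong (All.universal (λ x → cong f (sym (reverse-involutive x))) (mix c p U r V)) ⟩
  total (f ∘ reverse ∘ reverse) (mix c p U r V) ≡⟨ total-map (f ∘ reverse) reverse (mix c p U r V) ⟨
  total (f ∘ reverse) (map reverse (mix c p U r V)) ≡⟨ total-↭ (f ∘ reverse) (mix-mirror c p U r V) ⟩
  total (f ∘ reverse) (mix c r V p U) ∎
  where open ≡-Reasoning

split-two : ∀ j i (σ : Word) → length σ ≡ j + suc (suc i) →
  ∃₂ λ b x → ∃₂ λ y a → σ ≡ b ++ x ∷ y ∷ a × length b ≡ j × length a ≡ i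
split-two zero i (x ∷ y ∷ a) e = [] , x , y , a , refl , refl , ℕₚ.suc-injective (ℕₚ.suc-injective e)
split-two (suc j) i (z ∷ σ) e with split-two j i σ (ℕₚ.suc-injective e)
... | b , x , y , a , refl , lb , la = z ∷ b , x , y , a , refl , cong suc lb , la

reverse-two : ∀ b (x y : ℕ) a → reverse (b ++ x ∷ y ∷ a) ≡ reverse a ++ y ∷ x ∷ reverse b
reverse-two b x y a = begin
  reverse (b ++ x ∷ y ∷ a) ≡⟨ reverse-++ b (x ∷ y ∷ a) ⟩
  reverse (x ∷ y ∷ a) ++ reverse b ≡⟨ cong (_++ reverse b) (reverse-++ (x ∷ y ∷ []) a) ⟩
  (reverse a ++ y ∷ x ∷ []) ++ reverse b ≡⟨ ++-assoc (reverse a) _ (reverse b) ⟩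
  reverse a ++ y ∷ x ∷ reverse b ∎
  where open ≡-Reasoning

-- Reversing both the word and the order keeps descents descents; positions `i` and `j` name the
-- same pair counted from opposite ends.
step-mirror : ∀ i j σ → length σ ≡ j + suc (suc i) → step i (reverse σ) ≡ Maybe.map reverse (Opp.step j σ)
step-mirror i j σ e with split-two j i σ e
... | b , x , y , a , refl , refl , refl
  rewrite reverse-two b x y a | Opp.step-split b x y a
        | sym (length-reverse a) | Std.step-split (reverse a) y x (reverse b) with x <ᵇ y
... | true = cong just (sym (reverse-two b y x a))
... | false = refl

maybe-map : ∀ {A B : Set} (f : B → ℕ) (g : A → B) o → maybe′ f 0 (Maybe.map g o) ≡ maybe′ (f ∘ g) 0 o
maybe-map f g nothing = refl
maybe-map f g (just _) = refl

δ-++ : ∀ {a b} p q → length p ≡ length a → δ (p ++ q) (a ++ b) ≡ δ p a * δ q b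
δ-++ {[]} [] q _ = sym (ℕₚ.*-identityˡ _)
δ-++ {x ∷ a} {b} (y ∷ p) q e = begin
  bool ((y ≡ᵇ x) ∧ ((p ++ q) ==ᵂ (a ++ b))) ≡⟨ bool-∧ (y ≡ᵇ x) _ ⟩
  bool (y ≡ᵇ x) * δ (p ++ q) (a ++ b) ≡⟨ cong (bool (y ≡ᵇ x) *_) (δ-++ p q (ℕₚ.suc-injective e)) ⟩
  bool (y ≡ᵇ x) * (δ p a * δ q b) ≡⟨ ℕₚ.*-assoc (bool (y ≡ᵇ x)) _ _ ⟨
  (bool (y ≡ᵇ x) * δ p a) * δ q b ≡⟨ cong (_* δ q b) (bool-∧ (y ≡ᵇ x) _) ⟨
  bool ((y ≡ᵇ x) ∧ (p ==ᵂ a)) * δ q b ∎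
  where open ≡-Reasoning

-- Together with `late-∈` this excludes a `c` that stands away from its place in the sorted word.
early-∈ : ∀ {c ys as bs} (xs : Word) → xs ++ c ∷ ys ≡ as ++ bs → length xs < length as → c ∈ as
early-∈ {as = a ∷ as} [] e _ = here (∷-injectiveˡ e)
early-∈ {as = a ∷ as} (x ∷ xs) e (s≤s l) = there (early-∈ xs (∷-injectiveʳ e) l)

late-∈ : ∀ {c d ys bs} (xs as : Word) → xs ++ c ∷ ys ≡ as ++ d ∷ bs → length as < length xs → c ∈ bs
late-∈ (x ∷ xs) [] e _ = subst (_ ∈_) (∷-injectiveʳ e) (∈-++⁺ʳ xs (here refl))
late-∈ (x ∷ xs) (a ∷ as) e (s≤s l) = late-∈ xs as (∷-injectiveʳ e) l

-- Only words in the two base cases can be increasing: otherwise c is followed by a smaller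
-- letter of u or preceded by a larger letter of w.
mix-δ : ∀ c p U r V a b → length (p ++ flat U) ≡ length a → length (r ++ flat V) ≡ length b → c ∉ a → c ∉ b →
  total (λ π → δ π (a ++ c ∷ b)) (mix c p U r V) ≡ δ (p ++ c ∷ flat U) (a ++ c ∷ []) * δ (reverse (r ++ c ∷ flat V)) (c ∷ b)
mix-δ c p [] r V a b lu lv c∉a c∉b = begin
  δ (p ++ w) (a ++ c ∷ b) + 0 ≡⟨ ℕₚ.+-identityʳ _ ⟩
  δ (p ++ w) (a ++ c ∷ b) ≡⟨ δ-++ p w lp ⟩
  δ p a * δ w (c ∷ b) ≡⟨ cong (_* δ w (c ∷ b)) (sym {y = δ p a} (trans (δ-++ p (c ∷ []) lp) (trans (cong (δ p a *_) (δ-refl (c ∷ []))) (ℕₚ.*-identityʳ (δ p a))))) ⟩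
  δ (p ++ c ∷ []) (a ++ c ∷ []) * δ w (c ∷ b) ∎
  where
  open ≡-Reasoning
  w = reverse (r ++ c ∷ flat V)
  lp : length p ≡ length a
  lp = trans (cong length (sym (++-identityʳ p))) lu
mix-δ c p U@(_ ∷ _) r [] a b lu lv c∉a c∉b = begin
  δ (u ++ reverse r) (a ++ c ∷ b) + 0 ≡⟨ ℕₚ.+-identityʳ _ ⟩
  δ (u ++ reverse r) (a ++ c ∷ b) ≡⟨ cong (δ (u ++ reverse r)) (++-assoc a (c ∷ []) b) ⟨
  δ (u ++ reverse r) ((a ++ c ∷ []) ++ b) ≡⟨ δ-++ u (reverse r) l ⟩
  δ u (a ++ c ∷ []) * δ (reverse r) b ≡⟨ cong (δ u (a ++ c ∷ []) *_) (sym (trans (cong (λ z → δ z (c ∷ b)) (reverse-++ r (c ∷ []))) (cong (λ z → bool (z ∧ (reverse r ==ᵂ b))) (≡ᵇ-refl c)))) ⟩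
  δ u (a ++ c ∷ []) * δ (reverse (r ++ c ∷ [])) (c ∷ b) ∎
  where
  open ≡-Reasoning
  u = p ++ c ∷ flat U
  l : length u ≡ length (a ++ c ∷ [])
  l = trans (length-++-sucʳ p c (flat U)) (trans (cong suc (trans lu (sym (cong length (++-identityʳ a))))) (sym (length-++-sucʳ a c [])))
mix-δ c p U@((M , p′) ∷ U′) r V@((m , r′) ∷ V′) a b lu lv c∉a c∉b = trans
  (total-zero (Allₚ.++⁺ (Allₚ.map⁺ (All.universal (λ z → δ-≢ (λ e → c∉a (early-∈ p (trans (sym (++-assoc p (c ∷ []) z)) e) lp))) (mix M p′ U′ r V)))
    (Allₚ.map⁺ (All.map (λ {z} l → δ-≢ (λ e → c∉b (late-∈ z a (trans (cong (z ++_) (sym (reverse-++ r (c ∷ [])))) e) (subst (_< length z) lu l)))) (Std.mix-nonempty m p U r′ V′)))))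
  (sym (cong (_* δ (reverse (r ++ c ∷ flat V)) (c ∷ b)) (δ-≢ {p ++ c ∷ flat U} (λ e → c∉a (early-∈ p e lp)))))
  where
  lp : length p < length a
  lp = subst (length p <_) lu (subst (length p <_) (sym (length-++ p)) (ℕₚ.m<m+n (length p) (subst (0 <_) (sym (length-++-sucʳ p′ M (flat U′))) (s≤s z≤n))))

applyUpTo-+ : ∀ {A : Set} (f : ℕ → A) m n → applyUpTo f (m + n) ≡ applyUpTo f m ++ applyUpTo (λ i → f (m + i)) n
applyUpTo-+ f zero n = refl
applyUpTo-+ f (suc m) n = cong (f 0 ∷_) (applyUpTo-+ (f ∘ suc) m n)

range1-+ : ∀ m n → range1 (m + n) ≡ range1 m ++ shift m (range1 n)
range1-+ m n = begin
  range1 (m + n) ≡⟨ map-upTo suc (m + n) ⟩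
  applyUpTo suc (m + n) ≡⟨ applyUpTo-+ suc m n ⟩
  applyUpTo suc m ++ applyUpTo (λ i → suc (m + i)) n ≡⟨ cong₂ _++_ (map-upTo suc m) (map-upTo (λ i → suc (m + i)) n) ⟨
  range1 m ++ map (λ i → suc (m + i)) (upTo n) ≡⟨ cong (range1 m ++_) (map-cong (λ i → cong suc (ℕₚ.+-comm m i)) (upTo n)) ⟩
  range1 m ++ map (λ i → suc i + m) (upTo n) ≡⟨ cong (range1 m ++_) (map-∘ (upTo n)) ⟩
  range1 m ++ shift m (range1 n) ∎
  where open ≡-Reasoning

-- The tail of `range1 (suc n)` in the form to which that list computes.
range2 : ℕ → Word
range2 n = map suc (applyUpTo suc n)

paths-step : ∀ t i y {π π′} → step i π ≡ π′ → paths t (suc i ∷ y) π ≡ maybe′ (paths t y) 0 π′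
paths-step t i y refl = refl

-- Induction on `y`: by `undo-mix` and its mirror image, undoing a descent in all members amounts to
-- undoing it in one of the two words, so the sum factorises. The second target is shifted because
-- the second word keeps its letters from `m + 1` on.
mix-paths : ∀ m n y p U r V → All (Std._≺ suc m) p → Below Std._≺_ (suc m) U → All (Opp._≺ suc m) r → Below Opp._≺_ (suc m) V →
  length (p ++ flat U) ≡ m → length (r ++ flat V) ≡ n →
  total (paths (range1 (suc (m + n))) y) (mix (suc m) p U r V) ≡
  paths (range1 (suc m)) (lows m y) (p ++ suc m ∷ flat U) * paths (shift m (range1 (suc n))) (highs m y) (reverse (r ++ suc m ∷ flat V))
mix-paths m n [] p U r V p<c bU r>c bV lu lv = begin
  total (λ π → δ π (range1 (suc (m + n)))) (mix (suc m) p U r V)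
    ≡⟨ cong (λ t → total (λ π → δ π t) (mix (suc m) p U r V)) (trans (cong range1 (sym (ℕₚ.+-suc m n))) (range1-+ m (suc n))) ⟩
  total (λ π → δ π (range1 m ++ suc m ∷ b)) (mix (suc m) p U r V)
    ≡⟨ mix-δ (suc m) p U r V (range1 m) b (trans lu (sym (length-range1 m))) (trans lv (sym lb)) c∉a c∉b ⟩
  δ (p ++ suc m ∷ flat U) (range1 m ++ suc m ∷ []) * δ (reverse (r ++ suc m ∷ flat V)) (suc m ∷ b)
    ≡⟨ cong (λ t → δ (p ++ suc m ∷ flat U) t * δ (reverse (r ++ suc m ∷ flat V)) (suc m ∷ b)) (trans (sym (range1-+ m 1)) (cong range1 (ℕₚ.+-comm m 1))) ⟩
  δ (p ++ suc m ∷ flat U) (range1 (suc m)) * δ (reverse (r ++ suc m ∷ flat V)) (suc m ∷ b) ∎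
  where
  open ≡-Reasoning
  b = shift m (range2 n)
  lb : length b ≡ n
  lb = trans (length-map _ (range2 n)) (trans (length-map suc (applyUpTo suc n)) (length-applyUpTo suc n))
  c∉a : suc m ∉ range1 m
  c∉a q = ℕₚ.1+n≰n (proj₂ (All.lookup (range1-InRange m) q))
  c∉b : suc m ∉ b
  c∉b q with range1-increasing (suc n)
  ... | al ∷ _ = ℕₚ.<-irrefl refl (All.lookup b>c q)
    where
    b>c : All (suc m <_) b
    b>c = Allₚ.map⁺ (All.map (ℕₚ.+-monoˡ-< m) al)
-- `lows` keeps the letter 0, so the product on the right computes to 0.
mix-paths m n (zero ∷ y) p U r V p<c bU r>c bV lu lv = total-zero {f = paths (range1 (suc (m + n))) (zero ∷ y)} (All.universal (λ _ → refl) (mix (suc m) p U r V))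
mix-paths m n (suc i ∷ y) p U r V p<c bU r>c bV lu lv with i <ᵇ m in i<ᵇm
... | true = begin
  total (maybe′ f 0 ∘ step i) (mix c p U r V) ≡⟨ total-mapMaybe f (step i) (mix c p U r V) ⟨
  total f (Std.undo i (mix c p U r V)) ≡⟨ cong (total f) (Std.undo-mix c i p U r V p<c bU bV i<m) ⟩
  total f (Std.mixs c (Std.low i p U) r V) ≡⟨ rest (Std.low i p U) refl ⟩
  maybe′ (paths tu (lows m y)) 0 (Maybe.map join (Std.low i p U)) * q ≡⟨ cong (_* q) (paths-step tu i (lows m y) (Std.step-blocks i p U p<c bU i<m)) ⟨
  paths tu (suc i ∷ lows m y) (p ++ c ∷ flat U) * q ∎
  where
  open ≡-Reasoning
  c = suc m
  f = paths (range1 (suc (m + n))) y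
  tu = range1 (suc m)
  q = paths (shift m (range1 (suc n))) (highs m y) (reverse (r ++ suc m ∷ flat V))
  join : Word × Blocks → Word
  join (p , U) = p ++ c ∷ flat U
  i<m : i < length (p ++ flat U)
  i<m = subst (i <_) (sym lu) (<ᵇ-true⁻ i<ᵇm)
  rest : ∀ o → Std.low i p U ≡ o → total f (Std.mixs c o r V) ≡ maybe′ (paths tu (lows m y)) 0 (Maybe.map join o) * q
  rest nothing _ = refl
  rest (just (p′ , U′)) e with Std.low-valid i p U p<c bU e
  ... | p′<c , bU′ = mix-paths m n y p′ U′ r V p′<c bU′ r>c bV (trans (Std.low-length i p U e) lu) lv
-- Now `i = m + i′`, and the letter `suc i` of `y` appears as `suc i′` in `highs m y`.
... | false with i ∸ m | ℕₚ.m+[n∸m]≡n {m} {i} (<ᵇ-false⁻ {i} {m} i<ᵇm) | ℕₚ.+-∸-assoc 1 {i} {m} (<ᵇ-false⁻ {i} {m} i<ᵇm)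
... | i′ | refl | e₁ rewrite e₁ with i′ <ᵇ n in i′<ᵇn
-- The position is beyond the last pair, both in the members and in the second word, so both sides
-- are 0.
... | false = trans (total-zero (All.map (λ {π} l → paths-step (range1 (suc (m + n))) (m + i′) y (Std.step-none (m + i′) π l)) long))
    (sym (trans (cong (pu *_) (paths-step tw i′ (highs m y) (Std.step-none i′ (reverse (r ++ suc m ∷ flat V)) lw))) (ℕₚ.*-zeroʳ pu)))
  where
  tw = shift m (range1 (suc n))
  pu = paths (range1 (suc m)) (lows m y) (p ++ suc m ∷ flat U)
  lω : length (r ++ suc m ∷ flat V) ≡ suc n
  lω = trans (length-++-sucʳ r (suc m) (flat V)) (cong suc lv)
  lw : length (reverse (r ++ suc m ∷ flat V)) ≤ suc i′
  lw = subst (_≤ suc i′) (sym (trans (length-reverse (r ++ suc m ∷ flat V)) lω)) (s≤s (<ᵇ-false⁻ i′<ᵇn))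
  long : All (λ π → length π ≤ suc (m + i′)) (mix (suc m) p U r V)
  long = All.map (λ {π} q → ℕₚ.≤-trans (ℕₚ.≤-reflexive (trans (↭-length q) (trans (length-++ (p ++ flat U)) (cong₂ _+_ lu (cong suc lv)))))
    (ℕₚ.≤-trans (ℕₚ.≤-reflexive (ℕₚ.+-suc m n)) (s≤s (ℕₚ.+-monoʳ-≤ m (<ᵇ-false⁻ i′<ᵇn))))) (mix-↭ (suc m) p U r V)
-- `j` is the same pair counted from the end of the second word, hence a position of the first word
-- of the mirrored mix.
... | true with n ∸ suc i′ | ℕₚ.m∸n+n≡m {n} {suc i′} (<ᵇ-true⁻ i′<ᵇn)
... | j | refl = begin
  total (maybe′ f 0 ∘ step (m + i′)) (mix c p U r V) ≡⟨ total-mirror (maybe′ f 0 ∘ step (m + i′)) c p U r V ⟩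
  total (maybe′ f 0 ∘ step (m + i′) ∘ reverse) (mix c r V p U) ≡⟨ total-cong (All.map mirrored (mix-↭ c r V p U)) ⟩
  total (maybe′ (f ∘ reverse) 0 ∘ Opp.step j) (mix c r V p U) ≡⟨ total-mapMaybe (f ∘ reverse) (Opp.step j) (mix c r V p U) ⟨
  total (f ∘ reverse) (Opp.undo j (mix c r V p U)) ≡⟨ cong (total (f ∘ reverse)) (Opp.undo-mix c j r V p U r>c bV bU j<n) ⟩
  total (f ∘ reverse) (Opp.mixs c (Opp.low j r V) p U) ≡⟨ rest (Opp.low j r V) refl ⟩
  pu * maybe′ (paths tw (highs m y)) 0 (Maybe.map reverse (Maybe.map join (Opp.low j r V)))
    ≡⟨ cong (pu *_) (paths-step tw i′ (highs m y) (trans (step-mirror i′ j (r ++ c ∷ flat V) lω) (cong (Maybe.map reverse) (Opp.step-blocks j r V r>c bV j<n)))) ⟨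
  pu * paths tw (suc i′ ∷ highs m y) (reverse (r ++ c ∷ flat V)) ∎
  where
  open ≡-Reasoning
  c = suc m
  f = paths (range1 (suc (m + (j + suc i′)))) y
  tw = shift m (range1 (suc (j + suc i′)))
  pu = paths (range1 (suc m)) (lows m y) (p ++ suc m ∷ flat U)
  join : Word × Blocks → Word
  join (p , U) = p ++ c ∷ flat U
  lω : length (r ++ c ∷ flat V) ≡ j + suc (suc i′)
  lω = trans (length-++-sucʳ r c (flat V)) (trans (cong suc lv) (sym (ℕₚ.+-suc j (suc i′))))
  j<n : j < length (r ++ flat V)
  j<n = subst (j <_) (sym lv) (ℕₚ.m<m+n j (s≤s z≤n))
  mirrored : ∀ {σ} → σ ↭ (r ++ flat V) ++ c ∷ (p ++ flat U) →
    maybe′ f 0 (step (m + i′) (reverse σ)) ≡ maybe′ (f ∘ reverse) 0 (Opp.step j σ)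
  mirrored {σ} q = trans (cong (maybe′ f 0) (step-mirror (m + i′) j σ ls)) (maybe-map f reverse (Opp.step j σ))
    where
    ls : length σ ≡ j + suc (suc (m + i′))
    ls = begin
      length σ ≡⟨ ↭-length q ⟩
      length ((r ++ flat V) ++ c ∷ (p ++ flat U)) ≡⟨ length-++ (r ++ flat V) ⟩
      length (r ++ flat V) + suc (length (p ++ flat U)) ≡⟨ cong₂ (λ a b → a + suc b) lv lu ⟩
      (j + suc i′) + suc m ≡⟨ ℕₚ.+-assoc j (suc i′) (suc m) ⟩
      j + (suc i′ + suc m) ≡⟨ cong (j +_) (cong suc (trans (ℕₚ.+-suc i′ m) (cong suc (ℕₚ.+-comm i′ m)))) ⟩
      j + suc (suc (m + i′)) ∎
  rest : ∀ o → Opp.low j r V ≡ o → total (f ∘ reverse) (Opp.mixs c o p U) ≡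
    pu * maybe′ (paths tw (highs m y)) 0 (Maybe.map reverse (Maybe.map join o))
  rest nothing _ = sym (ℕₚ.*-zeroʳ pu)
  rest (just (r′ , V′)) e with Opp.low-valid j r V r>c bV e
  ... | r′>c , bV′ = trans (sym (total-mirror f c p U r′ V′))
    (mix-paths m (j + suc i′) y p U r′ V′ p<c bU r′>c bV′ lu (trans (Opp.low-length j r V e) lv))

-- Coefficients of the shuffle product

χ-map-∷-≢ : ∀ {i j} x W → i ≢ j → χ (i ∷ x) (map (j ∷_) W) ≡ 0
χ-map-∷-≢ {i} {j} x W i≢j = trans (χ-map-∷ i j x W) (cong (λ b → bool b * χ x W) (≡ᵇ-false i≢j))

shuffles-[] : ∀ a → shuffles a [] ≡ a ∷ []
shuffles-[] [] = refl
shuffles-[] (_ ∷ _) = refl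

-- As `z` does not occur in `b`, a shuffle starting with `z` must have taken the first letter of the
-- left word.
χ-shuffles-∷ˡ : ∀ z w x a b → All (z ≢_) b → χ (z ∷ x) (shuffles (w ∷ a) b) ≡ bool (z ≡ᵇ w) * χ x (shuffles a b)
χ-shuffles-∷ˡ z w x a [] _ = trans (χ-map-∷ z w x (a ∷ [])) (cong (λ W → bool (z ≡ᵇ w) * χ x W) (sym (shuffles-[] a)))
χ-shuffles-∷ˡ z w x a (y ∷ b) (z≢y ∷ _) = begin
  χ (z ∷ x) (map (w ∷_) (shuffles a (y ∷ b)) ++ map (y ∷_) (shuffles (w ∷ a) b)) ≡⟨ total-++ (δ (z ∷ x)) (map (w ∷_) (shuffles a (y ∷ b))) _ ⟩
  χ (z ∷ x) (map (w ∷_) (shuffles a (y ∷ b))) + χ (z ∷ x) (map (y ∷_) (shuffles (w ∷ a) b))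
    ≡⟨ cong₂ _+_ (χ-map-∷ z w x (shuffles a (y ∷ b))) (χ-map-∷-≢ x (shuffles (w ∷ a) b) z≢y) ⟩
  bool (z ≡ᵇ w) * χ x (shuffles a (y ∷ b)) + 0 ≡⟨ ℕₚ.+-identityʳ _ ⟩
  bool (z ≡ᵇ w) * χ x (shuffles a (y ∷ b)) ∎
  where open ≡-Reasoning

χ-shuffles-∷ʳ : ∀ z y x a b → All (z ≢_) a → χ (z ∷ x) (shuffles a (y ∷ b)) ≡ bool (z ≡ᵇ y) * χ x (shuffles a b)
χ-shuffles-∷ʳ z y x [] b _ = χ-map-∷ z y x (b ∷ [])
χ-shuffles-∷ʳ z y x (w ∷ a) b (z≢w ∷ _) = begin
  χ (z ∷ x) (map (w ∷_) (shuffles a (y ∷ b)) ++ map (y ∷_) (shuffles (w ∷ a) b)) ≡⟨ total-++ (δ (z ∷ x)) (map (w ∷_) (shuffles a (y ∷ b))) _ ⟩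
  χ (z ∷ x) (map (w ∷_) (shuffles a (y ∷ b))) + χ (z ∷ x) (map (y ∷_) (shuffles (w ∷ a) b))
    ≡⟨ cong₂ _+_ (χ-map-∷-≢ x (shuffles a (y ∷ b)) z≢w) (χ-map-∷ z y x (shuffles (w ∷ a) b)) ⟩
  bool (z ≡ᵇ y) * χ x (shuffles (w ∷ a) b) ∎
  where open ≡-Reasoning

δ-∷ : ∀ z w x y → δ (z ∷ x) (w ∷ y) ≡ bool (z ≡ᵇ w) * δ x y
δ-∷ z w x y = bool-∧ (z ≡ᵇ w) (x ==ᵂ y)

-- The alphabets are disjoint, so each letter of `x` reveals the word it comes from, and at most one
-- choice of positions produces `x`.
χ-shuffles : ∀ m x a b → All (_≤ m) a → All (m <_) b → χ x (shuffles a b) ≡ δ (lows m x) a * δ (highLetters m x) b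
χ-shuffles m [] [] [] _ _ = refl
χ-shuffles m [] [] (_ ∷ _) _ _ = refl
χ-shuffles m [] (_ ∷ _) [] _ _ = refl
χ-shuffles m [] (w ∷ a) (y ∷ b) _ _ = trans (total-++ (δ []) (map (w ∷_) (shuffles a (y ∷ b))) _)
  (cong₂ _+_ (total-zero (Allₚ.map⁺ (All.universal (λ _ → refl) (shuffles a (y ∷ b)))))
             (total-zero (Allₚ.map⁺ (All.universal (λ _ → refl) (shuffles (w ∷ a) b)))))
χ-shuffles m (z ∷ x) a b a≤m m<b with z <ᵇ suc m in z<ᵇ
χ-shuffles m (z ∷ x) [] b _ m<b | true = trans (ℕₚ.+-identityʳ _) (δ-≢ {z ∷ x} {b} λ { refl → ℕₚ.<⇒≱ (All.head m<b) (ℕₚ.≤-pred (<ᵇ-true⁻ z<ᵇ)) })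
χ-shuffles m (z ∷ x) (w ∷ a) b (_ ∷ a≤m) m<b | true = begin
  χ (z ∷ x) (shuffles (w ∷ a) b) ≡⟨ χ-shuffles-∷ˡ z w x a b (All.map (λ { l refl → ℕₚ.<⇒≱ l (ℕₚ.≤-pred (<ᵇ-true⁻ z<ᵇ)) }) m<b) ⟩
  bool (z ≡ᵇ w) * χ x (shuffles a b) ≡⟨ cong (bool (z ≡ᵇ w) *_) (χ-shuffles m x a b a≤m m<b) ⟩
  bool (z ≡ᵇ w) * (δ (lows m x) a * δ (highLetters m x) b) ≡⟨ ℕₚ.*-assoc (bool (z ≡ᵇ w)) _ _ ⟨
  bool (z ≡ᵇ w) * δ (lows m x) a * δ (highLetters m x) b ≡⟨ cong (_* δ (highLetters m x) b) (δ-∷ z w (lows m x) a) ⟨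
  δ (z ∷ lows m x) (w ∷ a) * δ (highLetters m x) b ∎
  where open ≡-Reasoning
χ-shuffles m (z ∷ x) a [] a≤m _ | false = begin
  χ (z ∷ x) (shuffles a []) ≡⟨ cong (χ (z ∷ x)) (shuffles-[] a) ⟩
  δ (z ∷ x) a + 0 ≡⟨ ℕₚ.+-identityʳ _ ⟩
  δ (z ∷ x) a ≡⟨ δ-≢ {z ∷ x} {a} (λ { refl → ℕₚ.<⇒≱ (<ᵇ-false⁻ {z} {suc m} z<ᵇ) (All.head a≤m) }) ⟩
  0 ≡⟨ ℕₚ.*-zeroʳ (δ (lows m x) a) ⟨
  δ (lows m x) a * 0 ∎
  where open ≡-Reasoning
χ-shuffles m (z ∷ x) a (y ∷ b) a≤m (_ ∷ m<b) | false = begin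
  χ (z ∷ x) (shuffles a (y ∷ b)) ≡⟨ χ-shuffles-∷ʳ z y x a b (All.map (λ { l refl → ℕₚ.<⇒≱ (<ᵇ-false⁻ {z} {suc m} z<ᵇ) l }) a≤m) ⟩
  bool (z ≡ᵇ y) * χ x (shuffles a b) ≡⟨ cong (bool (z ≡ᵇ y) *_) (χ-shuffles m x a b a≤m m<b) ⟩
  bool (z ≡ᵇ y) * (δ (lows m x) a * δ (highLetters m x) b) ≡⟨ ℕₚ.*-assoc (bool (z ≡ᵇ y)) _ _ ⟨
  bool (z ≡ᵇ y) * δ (lows m x) a * δ (highLetters m x) b ≡⟨ cong (_* δ (highLetters m x) b) (ℕₚ.*-comm (bool (z ≡ᵇ y)) _) ⟩
  δ (lows m x) a * bool (z ≡ᵇ y) * δ (highLetters m x) b ≡⟨ ℕₚ.*-assoc (δ (lows m x) a) _ _ ⟩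
  δ (lows m x) a * (bool (z ≡ᵇ y) * δ (highLetters m x) b) ≡⟨ cong (δ (lows m x) a *_) (δ-∷ z y (highLetters m x) b) ⟨
  δ (lows m x) a * δ (z ∷ highLetters m x) (y ∷ b) ∎
  where open ≡-Reasoning

≡ᵇ-+ : ∀ m k y → (k + m ≡ᵇ y + m) ≡ (k ≡ᵇ y)
≡ᵇ-+ m k y with k ≡ᵇ y in e
... | true rewrite ≡ᵇ-true⁻ {k} {y} e = ≡ᵇ-refl (y + m)
... | false = ≡ᵇ-false {k + m} {y + m} (λ q → case trans (sym e) (trans (cong (_≡ᵇ y) (ℕₚ.+-cancelʳ-≡ m k y q)) (≡ᵇ-refl y)) of λ ())

<ᵇ-+ : ∀ m k y → (k + m <ᵇ y + m) ≡ (k <ᵇ y)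
<ᵇ-+ m k y with k <ᵇ y in e
... | true = <ᵇ-true (ℕₚ.+-monoˡ-< m (<ᵇ-true⁻ {k} {y} e))
... | false = <ᵇ-false (ℕₚ.+-monoˡ-≤ m (<ᵇ-false⁻ {k} {y} e))

δ-shift : ∀ m x y → δ (shift m x) (shift m y) ≡ δ x y
δ-shift m [] [] = refl
δ-shift m [] (_ ∷ _) = refl
δ-shift m (_ ∷ _) [] = refl
δ-shift m (a ∷ x) (b ∷ y) rewrite ≡ᵇ-+ m a b with a ≡ᵇ b
... | true = δ-shift m x y
... | false = refl

shift-highs : ∀ m x → shift m (highs m x) ≡ highLetters m x
shift-highs m x = trans (sym (map-∘ (highLetters m x))) (map-id-local (go x))
  where
  go : ∀ x → All (λ z → z ∸ m + m ≡ z) (highLetters m x)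
  go [] = []
  go (z ∷ x) with z <ᵇ suc m in e
  ... | true = go x
  ... | false = ℕₚ.m∸n+n≡m (ℕₚ.<⇒≤ (<ᵇ-false⁻ {z} {suc m} e)) ∷ go x

step-shift : ∀ m i π → step i (shift m π) ≡ Maybe.map (shift m) (step i π)
step-shift m zero [] = refl
step-shift m zero (a ∷ []) = refl
step-shift m zero (a ∷ b ∷ π) rewrite <ᵇ-+ m b a with b <ᵇ a
... | true = refl
... | false = refl
step-shift m (suc i) [] = refl
step-shift m (suc i) (a ∷ π) rewrite step-shift m i π with step i π
... | just _ = refl
... | nothing = refl

-- Comparisons of letters do not see a shift, so the second factor of `mix-paths` is a path count
-- for `v` itself.
paths-shift : ∀ m t y π → paths (shift m t) y (shift m π) ≡ paths t y π
paths-shift m t [] π = δ-shift m π t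
paths-shift m t (zero ∷ y) π = refl
paths-shift m t (suc i ∷ y) π rewrite step-shift m i π with step i π
... | just π′ = paths-shift m t y π′
... | nothing = refl

filterᵇ-reverse : ∀ {A : Set} (p : A → Bool) x → filterᵇ p (reverse x) ≡ reverse (filterᵇ p x)
filterᵇ-reverse p [] = refl
filterᵇ-reverse p (z ∷ x) rewrite unfold-reverse z x
  | filter-++ (T? ∘ p) (reverse x) (z ∷ []) | filterᵇ-reverse p x with p z
... | true = sym (unfold-reverse z (filterᵇ p x))
... | false = ++-identityʳ _

count-total : ∀ b L → count b L ≡ total (bool ∘ eqBasis b) L
count-total b L = length-filterᵇ (eqBasis b) L

χ-basis : ∀ x N k (W : List Word) → total (bool ∘ eqBasis (x , N)) (map (λ w → w , k) W) ≡ χ x W * bool (N ≡ᵇ k)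
χ-basis x N k W = begin
  total (bool ∘ eqBasis (x , N)) (map (λ w → w , k) W) ≡⟨ total-map (bool ∘ eqBasis (x , N)) _ W ⟩
  total (λ w → bool ((x ==ᵂ w) ∧ (N ≡ᵇ k))) W ≡⟨ total-cong (All.universal (λ w → bool-∧ (x ==ᵂ w) (N ≡ᵇ k)) W) ⟩
  total (λ w → δ x w * bool (N ≡ᵇ k)) W ≡⟨ total-*ʳ (bool (N ≡ᵇ k)) (δ x) W ⟩
  χ x W * bool (N ≡ᵇ k) ∎
  where open ≡-Reasoning

-- Puts the letters of the two words to be shuffled into disjoint ranges, as `χ-shuffles` requires.
reducedWords-InRange : ∀ n π → π ↭ range1 (suc n) → All (All (InRange n)) (reducedWords n π)
reducedWords-InRange n π p rewrite reducedWords-inv n π p = All.map (proj₂ ∘ proj₁) (wordsWithProduct-all n π (inv π))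

count-∇sh : ∀ m n u v x N → u ↭ range1 (suc m) → v ↭ range1 (suc n) →
  count (x , N) (∇sh (bracket m u) (bracket n v)) ≡
  (χ (lows m x) (reducedWords m u) * χ (highs m x) (reducedWords n v)) * bool (N ≡ᵇ m + n)
count-∇sh m n u v x N pu pv = begin
  count (x , N) (∇sh (bracket m u) (bracket n v)) ≡⟨ count-total (x , N) (∇sh (bracket m u) (bracket n v)) ⟩
  total e (∇sh (bracket m u) (bracket n v)) ≡⟨ total-concatMap e _ (bracket m u) ⟩
  total (λ a → total e (concatMap (∇shBasis a) (bracket n v))) (bracket m u) ≡⟨ total-map _ (λ w → w , m) Ru ⟩
  total (λ a → total e (concatMap (∇shBasis (a , m)) (bracket n v))) Ru ≡⟨ total-cong (All.map inner (reducedWords-InRange m u pu)) ⟩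
  total (λ a → δ (lows m x) a * (χ (highs m x) Rv * ε)) Ru ≡⟨ total-*ʳ (χ (highs m x) Rv * ε) (δ (lows m x)) Ru ⟩
  χ (lows m x) Ru * (χ (highs m x) Rv * ε) ≡⟨ ℕₚ.*-assoc (χ (lows m x) Ru) _ _ ⟨
  (χ (lows m x) Ru * χ (highs m x) Rv) * ε ∎
  where
  open ≡-Reasoning
  e = bool ∘ eqBasis (x , N)
  ε = bool (N ≡ᵇ m + n)
  Ru = reducedWords m u
  Rv = reducedWords n v
  entry : ∀ a b → All (InRange m) a → All (InRange n) b →
    total e (∇shBasis (a , m) (b , n)) ≡ δ (lows m x) a * (δ (highs m x) b * ε)
  entry a b ra rb = begin
    total e (∇shBasis (a , m) (b , n)) ≡⟨ χ-basis x N (m + n) (shuffles a (shift m b)) ⟩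
    χ x (shuffles a (shift m b)) * ε ≡⟨ cong (_* ε) (χ-shuffles m x a (shift m b) (All.map proj₂ ra) (Allₚ.map⁺ (All.map (ℕₚ.+-monoˡ-≤ m ∘ proj₁) rb))) ⟩
    δ (lows m x) a * δ (highLetters m x) (shift m b) * ε ≡⟨ cong (λ h → δ (lows m x) a * δ h (shift m b) * ε) (shift-highs m x) ⟨
    δ (lows m x) a * δ (shift m (highs m x)) (shift m b) * ε ≡⟨ cong (λ h → δ (lows m x) a * h * ε) (δ-shift m (highs m x) b) ⟩
    δ (lows m x) a * δ (highs m x) b * ε ≡⟨ ℕₚ.*-assoc (δ (lows m x) a) _ _ ⟩
    δ (lows m x) a * (δ (highs m x) b * ε) ∎
  inner : ∀ {a} → All (InRange m) a → total e (concatMap (∇shBasis (a , m)) (bracket n v)) ≡ δ (lows m x) a * (χ (highs m x) Rv * ε)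
  inner {a} ra = begin
    total e (concatMap (∇shBasis (a , m)) (bracket n v)) ≡⟨ total-concatMap e _ (bracket n v) ⟩
    total (total e ∘ ∇shBasis (a , m)) (bracket n v) ≡⟨ total-map _ (λ w → w , n) Rv ⟩
    total (λ b → total e (∇shBasis (a , m) (b , n))) Rv ≡⟨ total-cong (All.map (λ {b} rb → entry a b ra rb) (reducedWords-InRange n v pv)) ⟩
    total (λ b → δ (lows m x) a * (δ (highs m x) b * ε)) Rv ≡⟨ total-*ˡ (δ (lows m x) a) _ Rv ⟩
    δ (lows m x) a * total (λ b → δ (highs m x) b * ε) Rv ≡⟨ cong (δ (lows m x) a *_) (total-*ʳ ε (δ (highs m x)) Rv) ⟩
    δ (lows m x) a * (χ (highs m x) Rv * ε) ∎

count-brackets : ∀ k x N L → All (_↭ range1 (suc k)) L →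
  count (x , N) (concatMap (bracket k) L) ≡ total (paths (range1 (suc k)) (reverse x)) L * bool (N ≡ᵇ k)
count-brackets k x N L al = begin
  count (x , N) (concatMap (bracket k) L) ≡⟨ count-total (x , N) (concatMap (bracket k) L) ⟩
  total (bool ∘ eqBasis (x , N)) (concatMap (bracket k) L) ≡⟨ total-concatMap (bool ∘ eqBasis (x , N)) (bracket k) L ⟩
  total (λ π → total (bool ∘ eqBasis (x , N)) (bracket k π)) L
    ≡⟨ total-cong (All.map (λ {π} p → trans (χ-basis x N k (reducedWords k π)) (cong (_* bool (N ≡ᵇ k)) (χ-reducedWords k x π p))) al) ⟩
  total (λ π → paths (range1 (suc k)) (reverse x) π * bool (N ≡ᵇ k)) L ≡⟨ total-*ʳ (bool (N ≡ᵇ k)) _ L ⟩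
  total (paths (range1 (suc k)) (reverse x)) L * bool (N ≡ᵇ k) ∎
  where open ≡-Reasoning

highs-reverse : ∀ m x → highs m (reverse x) ≡ reverse (highs m x)
highs-reverse m x = trans (cong (map (_∸ m)) (filterᵇ-reverse _ x)) (reverse-map (_∸ m) (highLetters m x))

-- Both coefficients are the same product of two path counts; the work left is to move reversals and
-- the shift through it.
count-mix : ∀ m n p U r V v → All (Std._≺ suc m) p → Below Std._≺_ (suc m) U → All (Opp._≺ suc m) r → Below Opp._≺_ (suc m) V →
  p ++ suc m ∷ flat U ↭ range1 (suc m) → v ↭ range1 (suc n) → shift m v ≡ reverse (r ++ suc m ∷ flat V) →
  All (_↭ range1 (suc (m + n))) (mix (suc m) p U r V) →
  ∀ b → count b (∇sh (bracket m (p ++ suc m ∷ flat U)) (bracket n v)) ≡ count b (concatMap (bracket (m + n)) (mix (suc m) p U r V))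
count-mix m n p U r V v p<c bU r>c bV pu pv ev al (x , N) = begin
  count (x , N) (∇sh (bracket m u) (bracket n v)) ≡⟨ count-∇sh m n u v x N pu pv ⟩
  (χ (lows m x) (reducedWords m u) * χ (highs m x) (reducedWords n v)) * ε
    ≡⟨ cong (_* ε) (cong₂ _*_ (χ-reducedWords m (lows m x) u pu) (χ-reducedWords n (highs m x) v pv)) ⟩
  (paths tu (reverse (lows m x)) u * paths (range1 (suc n)) (reverse (highs m x)) v) * ε
    ≡⟨ cong (_* ε) (cong₂ _*_ (cong (λ y → paths tu y u) (sym (filterᵇ-reverse (_<ᵇ suc m) x)))
         (trans (sym (paths-shift m (range1 (suc n)) (reverse (highs m x)) v)) (cong₂ (paths (shift m (range1 (suc n)))) (sym (highs-reverse m x)) ev))) ⟩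
  (paths tu (lows m (reverse x)) u * paths (shift m (range1 (suc n))) (highs m (reverse x)) (reverse (r ++ suc m ∷ flat V))) * ε
    ≡⟨ cong (_* ε) (mix-paths m n (reverse x) p U r V p<c bU r>c bV lu lv) ⟨
  total (paths (range1 (suc (m + n))) (reverse x)) (mix (suc m) p U r V) * ε ≡⟨ count-brackets (m + n) x N (mix (suc m) p U r V) al ⟨
  count (x , N) (concatMap (bracket (m + n)) (mix (suc m) p U r V)) ∎
  where
  open ≡-Reasoning
  u = p ++ suc m ∷ flat U
  ε = bool (N ≡ᵇ m + n)
  tu = range1 (suc m)
  lu : length (p ++ flat U) ≡ m
  lu = ℕₚ.suc-injective (trans (sym (length-++-sucʳ p (suc m) (flat U))) (trans (↭-length pu) (length-range1 (suc m))))
  lv : length (r ++ flat V) ≡ n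
  lv = ℕₚ.suc-injective (begin
    suc (length (r ++ flat V)) ≡⟨ length-++-sucʳ r (suc m) (flat V) ⟨
    length (r ++ suc m ∷ flat V) ≡⟨ length-reverse (r ++ suc m ∷ flat V) ⟨
    length (reverse (r ++ suc m ∷ flat V)) ≡⟨ cong length ev ⟨
    length (shift m v) ≡⟨ length-map (_+ m) v ⟩
    length v ≡⟨ trans (↭-length pv) (length-range1 (suc n)) ⟩
    suc n ∎)

-- The recursion 𝓢′ as a mix

increasing-unique : ∀ {xs} → AllPairs _<_ xs → Unique xs
increasing-unique = AllPairs.map ℕₚ.<⇒≢

elemᵇ-∈ : ∀ {y A} → y ∈ A → elemᵇ y A ≡ true
elemᵇ-∈ {y} (here refl) rewrite ≡ᵇ-refl y = refl
elemᵇ-∈ {y} {a ∷ A} (there q) with y ≡ᵇ a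
... | true = refl
... | false = elemᵇ-∈ q

elemᵇ-∉ : ∀ {y A} → y ∉ A → elemᵇ y A ≡ false
elemᵇ-∉ {y} {[]} _ = refl
elemᵇ-∉ {y} {a ∷ A} y∉ rewrite ≡ᵇ-false {y} {a} (y∉ ∘ here) = elemᵇ-∉ (y∉ ∘ there)

unique-++ : ∀ {A X : Word} → Unique (A ++ X) → ∀ {x} → x ∈ X → x ∉ A
unique-++ {a ∷ A} (a≢ ∷ _) x∈X (here refl) = All.lookup (Allₚ.++⁻ʳ A a≢) x∈X refl
unique-++ {a ∷ A} (_ ∷ un) x∈X (there q) = unique-++ un x∈X q

filterᵇ-none : ∀ (p : ℕ → Bool) {xs} → All (λ x → p x ≡ false) xs → filterᵇ p xs ≡ []
filterᵇ-none p [] = refl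
filterᵇ-none p (e ∷ al) rewrite e = filterᵇ-none p al

filterᵇ-all : ∀ (p : ℕ → Bool) {xs} → All (λ x → p x ≡ true) xs → filterᵇ p xs ≡ xs
filterᵇ-all p [] = refl
filterᵇ-all p (e ∷ al) rewrite e = cong (_ ∷_) (filterᵇ-all p al)

-- With `compl-increasing`, this turns the complement into the sorted arrangement of the known
-- letters `X`.
compl-↭ : ∀ A X N → A ++ X ↭ range1 N → compl A N ↭ X
compl-↭ A X N q = begin
  filterᵇ p (range1 N) ↭⟨ filter-↭ (T? ∘ p) q ⟨
  filterᵇ p (A ++ X) ≡⟨ filter-++ (T? ∘ p) A X ⟩
  filterᵇ p A ++ filterᵇ p X ≡⟨ cong₂ _++_
      (filterᵇ-none p {A} (All.tabulate (λ x∈A → cong not (elemᵇ-∈ {A = A} x∈A))))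
      (filterᵇ-all p {X} (All.tabulate (λ x∈X → cong not (elemᵇ-∉ {A = A} (unique-++ un x∈X))))) ⟩
  X ∎
  where
  open PermutationReasoning
  p : ℕ → Bool
  p y = not (elemᵇ y A)
  un : Unique (A ++ X)
  un = Unique-resp-↭ (↭-sym q) (increasing-unique (range1-increasing N))

compl-increasing : ∀ A N → AllPairs _<_ (compl A N)
compl-increasing A N = AllPairsₚ.filter⁺ _ (range1-increasing N)

-- In an increasing list the letters before `x` are exactly the smaller ones.
nth-rank : ∀ {C x} → AllPairs _<_ C → x ∈ C → nth C (rank x C) ≡ x
nth-rank {c ∷ C} (al ∷ _) (here refl) rewrite rank-cons-≥ {c} C ℕₚ.≤-refl | rank-none (All.map ℕₚ.<⇒≤ al) = refl
nth-rank {c ∷ C} (al ∷ s) (there q) rewrite rank-cons-< C (All.lookup al q) = nth-rank s q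

nth-∈ : ∀ C {i} → i < length C → nth C i ∈ C
nth-∈ (c ∷ C) {zero} _ = here refl
nth-∈ (c ∷ C) {suc i} (s≤s l) = there (nth-∈ C l)

nth-mono : ∀ {C i j} → AllPairs _<_ C → i < j → j < length C → nth C i < nth C j
nth-mono {c ∷ C} {zero} {suc j} (al ∷ _) _ (s≤s l) = All.lookup al (nth-∈ C l)
nth-mono {c ∷ C} {suc i} {suc j} (_ ∷ s) (s≤s i<j) (s≤s l) = nth-mono s i<j l

rank-++ : ∀ x s t → rank x (s ++ t) ≡ rank x s + rank x t
rank-++ x s t = trans (cong length (filter-++ (T? ∘ (_<ᵇ x)) s t)) (length-++ (filterᵇ (_<ᵇ x) s))

rank-all : ∀ {x s} → All (_< x) s → rank x s ≡ length s
rank-all [] = refl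
rank-all {x} (_∷_ {x = y} {s} l al) = trans (rank-cons-< s l) (cong suc (rank-all al))

rank-shift : ∀ m y s → rank (y + m) (shift m s) ≡ rank y s
rank-shift m y [] = refl
rank-shift m y (z ∷ s) rewrite <ᵇ-+ m z y with z <ᵇ y
... | true = cong suc (rank-shift m y s)
... | false = rank-shift m y s

rank-increasing : ∀ {C} → AllPairs _<_ C → map (λ x → rank x C) C ≡ upTo (length C)
rank-increasing [] = refl
rank-increasing {c ∷ C} (al ∷ s) = cong₂ _∷_
  (trans (rank-cons-≥ {c} {c} C ℕₚ.≤-refl) (rank-none (All.map ℕₚ.<⇒≤ al)))
  (begin
    map (λ x → rank x (c ∷ C)) C ≡⟨ map-cong-local (All.map (rank-cons-< C) al) ⟩
    map (λ x → suc (rank x C)) C ≡⟨ map-∘ C ⟩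
    map suc (map (λ x → rank x C) C) ≡⟨ cong (map suc) (rank-increasing s) ⟩
    map suc (upTo (length C)) ≡⟨ map-upTo suc (length C) ⟩
    applyUpTo suc (length C) ∎)
  where open ≡-Reasoning

-- Along the sorted arrangement `C` the ranks are 0, 1, 2, and so on; `s` has the same letters in
-- another order.
fl-↭ : ∀ {s C} → C ↭ s → AllPairs _<_ C → fl s ↭ range1 (length s)
fl-↭ {s} {C} q inc = begin
  map (λ x → suc (rank x s)) s ↭⟨ ↭-map⁺ _ q ⟨
  map (λ x → suc (rank x s)) C ≡⟨ map-cong (λ x → cong suc (rank-↭ x (↭-sym q))) C ⟩
  map (λ x → suc (rank x C)) C ≡⟨ map-∘ C ⟩
  map suc (map (λ x → rank x C) C) ≡⟨ cong (map suc) (rank-increasing inc) ⟩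
  range1 (length C) ≡⟨ cong range1 (↭-length q) ⟩
  range1 (length s) ∎
  where open PermutationReasoning

rank-range1 : ∀ {k x} → InRange k x → rank x (range1 k) ≡ pred x
rank-range1 {k} {suc i} (_ , i<k) = trans (cong (rank (suc i)) (map-upTo suc k)) (go suc s≤s k i i<k)
  where
  go : ∀ f → (∀ {a b} → a < b → f a < f b) → ∀ k i → i < k → rank (f i) (applyUpTo f k) ≡ i
  go f mono (suc k) zero _ = trans (rank-cons-≥ {f 0} {f 0} _ ℕₚ.≤-refl) (rank-none {f 0} (Allₚ.applyUpTo⁺₁ (f ∘ suc) k (λ _ → ℕₚ.<⇒≤ (mono (s≤s z≤n)))))
  go f mono (suc k) (suc i) (s≤s l) = trans (rank-cons-< (applyUpTo (f ∘ suc) k) (mono (s≤s z≤n))) (cong suc (go (f ∘ suc) (λ q → mono (s≤s q)) k i l))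

-- Both // and \\ renumber a permutation of 1..k by this map.
relabel : Word → ℕ → ℕ → ℕ
relabel A N x = nth (compl A N) (pred x)

Mono : (ℕ → ℕ) → ℕ → Set
Mono g N = ∀ {x y} → 1 ≤ x → x < y → y ≤ N → g x < g y

-- `h` enumerates the letters of `X` in increasing order, so it is the inverse of the renaming by
-- `fl`.
module Relabel (A X : Word) (N : ℕ) (q : A ++ X ↭ range1 N) where

  h : ℕ → ℕ
  h = relabel A N

  relabel-rank : ∀ {x} → x ∈ X → h (suc (rank x X)) ≡ x
  relabel-rank {x} x∈X rewrite rank-↭ x (↭-sym (compl-↭ A X N q)) = nth-rank (compl-increasing A N) (∈-resp-↭ (↭-sym (compl-↭ A X N q)) x∈X)

  private
    in-bounds : ∀ {i} → i < length X → i < length (compl A N)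
    in-bounds = subst (_ <_) (sym (↭-length (compl-↭ A X N q)))

  relabel-InRange : ∀ {x} → InRange (length X) x → InRange N (h x)
  relabel-InRange {suc i} (_ , l) = All.lookup (Allₚ.filter⁺ _ (range1-InRange N)) (nth-∈ (compl A N) (in-bounds l))

  relabel-mono : Mono h (length X)
  relabel-mono {suc i} {suc j} _ (s≤s i<j) l = nth-mono (compl-increasing A N) i<j (in-bounds l)

  mono-relabel : ∀ {g} → Mono g N → Mono (g ∘ h) (length X)
  mono-relabel mono 1≤x x<y l = mono (proj₁ (relabel-InRange (1≤x , ℕₚ.≤-trans (ℕₚ.<⇒≤ x<y) l))) (relabel-mono 1≤x x<y l)
    (proj₂ (relabel-InRange (ℕₚ.≤-trans 1≤x (ℕₚ.<⇒≤ x<y) , l)))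

  -- In a permutation the rank of a letter is the letter minus one.
  orderMap-relabel : ∀ σ → σ ↭ range1 (length X) → map (orderMap A σ N) σ ≡ map h σ
  orderMap-relabel σ p = map-cong-local (All.map (λ {x} r → cong (nth (compl A N)) (trans (rank-↭ x p) (rank-range1 r))) (All-resp-↭ (↭-sym p) (range1-InRange (length X))))

map-split : ∀ (g : ℕ → ℕ) u {p c F} → map g u ≡ p ++ c ∷ F →
  ∃₂ λ u₁ z → ∃ λ u₂ → u ≡ u₁ ++ z ∷ u₂ × map g u₁ ≡ p × g z ≡ c × map g u₂ ≡ F
map-split g (z ∷ u) {[]} refl = [] , z , u , refl , refl , refl , refl
map-split g (x ∷ u) {y ∷ p} e with map-split g u {p} (∷-injectiveʳ e)
... | u₁ , z , u₂ , refl , e₁ , e₂ , e₃ = x ∷ u₁ , z , u₂ , refl , cong₂ _∷_ (∷-injectiveˡ e) e₁ , e₂ , e₃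

range1-∷ : ∀ n → range1 (suc n) ≡ 1 ∷ shift 1 (range1 n)
range1-∷ n = range1-+ 1 n

range1-∷ʳ : ∀ m → range1 (suc m) ≡ range1 m ++ suc m ∷ []
range1-∷ʳ m = trans (cong range1 (ℕₚ.+-comm 1 m)) (range1-+ m 1)

shift-+ : ∀ m n s → shift m (shift n s) ≡ shift (n + m) s
shift-+ m n s = trans (sym (map-∘ s)) (map-cong (λ x → ℕₚ.+-assoc x n m) s)

remove-max : ∀ m p s → p ++ suc m ∷ s ↭ range1 (suc m) → p ++ s ↭ range1 m
remove-max m p s q = ↭-trans (drop-mid p (range1 m) (↭-trans q (↭-reflexive (range1-∷ʳ m)))) (↭-reflexive (++-identityʳ (range1 m)))

remove-min : ∀ n q r → q ++ 1 ∷ r ↭ range1 (suc n) → q ++ r ↭ shift 1 (range1 n)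
remove-min n q r p = drop-mid q [] (↭-trans p (↭-reflexive (range1-∷ n)))

remove-max-range : ∀ m p s → p ++ suc m ∷ s ↭ range1 (suc m) → All (InRange m) (p ++ s)
remove-max-range m p s q = All-resp-↭ (↭-sym (remove-max m p s q)) (range1-InRange m)

remove-min-range : ∀ n q r → q ++ 1 ∷ r ↭ range1 (suc n) → All (1 <_) (q ++ r)
remove-min-range n q r p = All-resp-↭ (↭-sym (remove-min n q r p))
  (Allₚ.map⁺ (All.map (λ (l , _) → ℕₚ.≤-trans (s≤s l) (ℕₚ.≤-reflexive (ℕₚ.+-comm 1 _))) (range1-InRange n)))

-- The minimum of the shifted second word is left out, since it equals the maximum of `u`.
merged-↭ : ∀ m n u q r → u ↭ range1 (suc m) → q ++ 1 ∷ r ↭ range1 (suc n) → u ++ shift m (q ++ r) ↭ range1 (suc (m + n))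
merged-↭ m n u q r pu pv = begin
  u ++ shift m (q ++ r) ↭⟨ ++⁺ pu (↭-map⁺ (_+ m) (remove-min n q r pv)) ⟩
  range1 (suc m) ++ shift m (shift 1 (range1 n)) ≡⟨ cong (range1 (suc m) ++_) (shift-+ m 1 (range1 n)) ⟩
  range1 (suc m) ++ shift (suc m) (range1 n) ≡⟨ range1-+ (suc m) n ⟨
  range1 (suc (m + n)) ∎
  where open PermutationReasoning

indexOf-length : ∀ z p s → z ∉ p → indexOf z (p ++ z ∷ s) ≡ length p
indexOf-length z [] s _ rewrite ≡ᵇ-refl z = refl
indexOf-length z (x ∷ p) s z∉ rewrite ≡ᵇ-false {z} {x} (z∉ ∘ here) = cong suc (indexOf-length z p s (z∉ ∘ there))

take-length : ∀ (p s : Word) → take (length p) (p ++ s) ≡ p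
take-length [] s = refl
take-length (x ∷ p) s = cong (x ∷_) (take-length p s)

take-suc-length : ∀ (p : Word) z s → take (suc (length p)) (p ++ z ∷ s) ≡ p ++ z ∷ []
take-suc-length [] z s = refl
take-suc-length (x ∷ p) z s = cong (x ∷_) (take-suc-length p z s)

drop-suc-length : ∀ (p : Word) z s → drop (suc (length p)) (p ++ z ∷ s) ≡ s
drop-suc-length [] z s = refl
drop-suc-length (x ∷ p) z s = drop-suc-length p z s

lastOr0-++ : ∀ p z s → lastOr0 (p ++ z ∷ s) ≡ lastOr0 (z ∷ s)
lastOr0-++ [] z s = refl
lastOr0-++ (x ∷ []) z s = refl
lastOr0-++ (x ∷ y ∷ p) z s = lastOr0-++ (y ∷ p) z s

lastOr0-∈ : ∀ y s → lastOr0 (y ∷ s) ∈ y ∷ s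
lastOr0-∈ y [] = here refl
lastOr0-∈ y (z ∷ s) = there (lastOr0-∈ z s)

-- One unfolding of `𝓢′` with `pred (length u)` made a parameter, so that all its occurrences can be
-- replaced by `m` at once.
𝓢-body : ℕ → ℕ → Word → Word → List Word
𝓢-body f m u v =
  if lastOr0 u ≡ᵇ suc m then (take m u ++ w) ∷ []
  else if headOr0 w ≡ᵇ suc m then (u ++ drop 1 w) ∷ []
  else (map (take j u //_) (𝓢′ f (fl (drop j u)) v) ++ map (_\\ drop k w) (𝓢′ f u (fl (take k v))))
  where
  w = shift m v
  j = suc (indexOf (suc m) u)
  k = indexOf (suc m) w

𝓢-unfold : ∀ f m u v → length u ≡ suc m → 𝓢′ (suc f) u v ≡ 𝓢-body f m u v
𝓢-unfold f m u v e = cong (λ k → 𝓢-body f (pred k) u v) e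

𝓢-last : ∀ f m p v → length p ≡ m → 𝓢-body f m (p ++ suc m ∷ []) v ≡ (p ++ shift m v) ∷ []
𝓢-last f m p v refl rewrite lastOr0-++ p (suc (length p)) [] | ≡ᵇ-refl (length p) | take-length p (suc (length p) ∷ []) = refl

𝓢-head : ∀ f m p y s r → suc m ∉ y ∷ s → 𝓢-body f m (p ++ suc m ∷ y ∷ s) (1 ∷ r) ≡ ((p ++ suc m ∷ y ∷ s) ++ shift m r) ∷ []
𝓢-head f m p y s r ∉s
  rewrite lastOr0-++ p (suc m) (y ∷ s) | ≡ᵇ-false {lastOr0 (y ∷ s)} {suc m} (λ e → ∉s (subst (_∈ y ∷ s) e (lastOr0-∈ y s)))
        | ≡ᵇ-refl m = refl

shift-∉ : ∀ m q → 1 ∉ q → suc m ∉ shift m q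
shift-∉ m (z ∷ q) 1∉ (here e) = 1∉ (here (ℕₚ.+-cancelʳ-≡ m 1 z e))
shift-∉ m (z ∷ q) 1∉ (there e) = shift-∉ m q (1∉ ∘ there) e

-- The letters `y` and `x` witness that `m + 1` is neither last in the first word nor first in the
-- second, so cases (a) and (b) fail.
𝓢-rec : ∀ f m p y s x q r → suc m ∉ p → suc m ∉ y ∷ s → 1 ∉ x ∷ q →
  𝓢-body f m (p ++ suc m ∷ y ∷ s) ((x ∷ q) ++ 1 ∷ r) ≡
  map ((p ++ suc m ∷ []) //_) (𝓢′ f (fl (y ∷ s)) ((x ∷ q) ++ 1 ∷ r)) ++
  map (_\\ (suc m ∷ shift m r)) (𝓢′ f (p ++ suc m ∷ y ∷ s) (fl (x ∷ q)))
𝓢-rec f m p y s x q r ∉p ∉s ∉q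
  rewrite lastOr0-++ p (suc m) (y ∷ s) | ≡ᵇ-false {lastOr0 (y ∷ s)} {suc m} (λ e → ∉s (subst (_∈ y ∷ s) e (lastOr0-∈ y s)))
        | ≡ᵇ-false {x + m} {suc m} (λ e → ∉q (here (sym (ℕₚ.+-cancelʳ-≡ m x 1 e))))
        | ≡ᵇ-false {suc m} {x + m} (λ e → ∉q (here (ℕₚ.+-cancelʳ-≡ m 1 x e)))
        | indexOf-length (suc m) p (y ∷ s) ∉p
        | take-suc-length p (suc m) (y ∷ s) | drop-suc-length p (suc m) (y ∷ s)
        | map-++ (_+ m) q (1 ∷ r)
        | indexOf-length (suc m) (shift m q) (shift m r) (shift-∉ m q (∉q ∘ there))
        | drop-length (shift m q) (suc m ∷ shift m r)
        | length-map (_+ m) q | take-length q (1 ∷ r) = refl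

Mono-reflects : ∀ {g N x y} → Mono g N → InRange N x → InRange N y → g x < g y → x < y
Mono-reflects {g} {N} {x} {y} mono (1≤x , x≤N) (1≤y , y≤N) gx<gy with ℕₚ.<-cmp x y
... | tri< x<y _ _ = x<y
... | tri≈ _ refl _ = contradiction gx<gy (ℕₚ.<-irrefl refl)
... | tri> _ _ y<x = contradiction (mono 1≤y y<x x≤N) (ℕₚ.<-asym gx<gy)

Mono-injective : ∀ {g N x y} → Mono g N → InRange N x → InRange N y → g x ≡ g y → x ≡ y
Mono-injective {g} {N} {x} {y} mono (1≤x , x≤N) (1≤y , y≤N) e with ℕₚ.<-cmp x y
... | tri< x<y _ _ = contradiction e (ℕₚ.<⇒≢ (mono 1≤x x<y y≤N))
... | tri≈ _ x≡y _ = x≡y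
... | tri> _ _ y<x = contradiction (sym e) (ℕₚ.<⇒≢ (mono 1≤y y<x x≤N))

-- The branch with `//`. Here `h` sends the letters of the recursive call back to the remaining
-- ones: `fl s` to `s`, each `y + m̃` with `y > 1` to `y + m`, and the shared letter `m̃ + 1` to the
-- maximum of `s`.
module Left (m n m̃ : ℕ) (p s q r : Word) (pu : p ++ suc m ∷ s ↭ range1 (suc m)) (pv : q ++ 1 ∷ r ↭ range1 (suc n))
  (ls : length s ≡ suc m̃) where

  A X : Word
  A = p ++ suc m ∷ []
  X = s ++ shift m (q ++ r)

  A++X : A ++ X ↭ range1 (suc (m + n))
  A++X = ↭-trans (↭-reflexive (trans (sym (++-assoc A s _)) (cong (_++ shift m (q ++ r)) (++-assoc p (suc m ∷ []) s)))) (merged-↭ m n _ q r pu pv)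

  open Relabel A X (suc (m + n)) A++X public

  s-range : All (InRange m) s
  s-range = Allₚ.++⁻ʳ p (remove-max-range m p s pu)

  q++r-range : All (1 <_) (q ++ r)
  q++r-range = remove-min-range n q r pv

  length-X : length X ≡ suc (m̃ + n)
  length-X = begin
    length X ≡⟨ length-++ s ⟩
    length s + length (shift m (q ++ r)) ≡⟨ cong₂ _+_ ls (trans (length-map (_+ m) (q ++ r)) (trans (↭-length (remove-min n q r pv)) (trans (length-map (_+ 1) (range1 n)) (length-range1 n)))) ⟩
    suc (m̃ + n) ∎
    where open ≡-Reasoning

  fl-s : fl s ↭ range1 (suc m̃)
  fl-s = ↭-trans (fl-↭ (compl-↭ A s (suc m) (↭-trans (↭-reflexive (++-assoc p (suc m ∷ []) s)) pu)) (compl-increasing A (suc m))) (↭-reflexive (cong range1 ls))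

  h-low : ∀ {x} → x ∈ s → h (suc (rank x s)) ≡ x
  h-low {x} x∈s = trans (cong (h ∘ suc) (sym rk)) (relabel-rank (∈-++⁺ˡ x∈s))
    where
    rk : rank x X ≡ rank x s
    rk = trans (rank-++ x s _) (trans (cong (rank x s +_) (rank-none (Allₚ.map⁺ (All.universal (λ y → ℕₚ.≤-trans (proj₂ (All.lookup s-range x∈s)) (ℕₚ.m≤n+m m y)) (q ++ r))))) (ℕₚ.+-identityʳ _))

  h-fl : map h (fl s) ≡ s
  h-fl = trans (sym (map-∘ s)) (map-id-local (All.tabulate h-low))

  h-high : ∀ {y} → y ∈ q ++ r → h (y + m̃) ≡ y + m
  h-high {y} y∈ = trans (cong h e) (relabel-rank (∈-++⁺ʳ s (∈-map⁺ (_+ m) y∈)))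
    where
    open ≡-Reasoning
    1<y : 1 < y
    1<y = All.lookup q++r-range y∈
    y∈v : InRange (suc n) y
    y∈v = All.lookup (range1-InRange (suc n)) (∈-resp-↭ pv (∈-resp-↭ (↭-sym (↭-shift 1 q r)) (there y∈)))
    rk : suc (rank y (q ++ r)) ≡ pred y
    rk = begin
      suc (rank y (q ++ r)) ≡⟨ rank-cons-< (q ++ r) 1<y ⟨
      rank y (1 ∷ q ++ r) ≡⟨ rank-↭ y (↭-trans (↭-sym (↭-shift 1 q r)) pv) ⟩
      rank y (range1 (suc n)) ≡⟨ rank-range1 y∈v ⟩
      pred y ∎
    e : y + m̃ ≡ suc (rank (y + m) X)
    e = begin
      y + m̃ ≡⟨ cong (_+ m̃) (ℕₚ.suc-pred y ⦃ >-nonZero (proj₁ y∈v) ⦄) ⟨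
      suc (pred y) + m̃ ≡⟨ cong (λ k → suc k + m̃) rk ⟨
      suc (suc (rank y (q ++ r))) + m̃ ≡⟨ cong (suc ∘ suc) (ℕₚ.+-comm (rank y (q ++ r)) m̃) ⟩
      suc (suc m̃ + rank y (q ++ r)) ≡⟨ cong suc (cong₂ _+_ (sym (trans (rank-all (All.map (λ (_ , l) → ℕₚ.≤-<-trans l (ℕₚ.m<n+m m (ℕₚ.<-trans (s≤s z≤n) 1<y))) s-range)) ls)) (sym (rank-shift m y (q ++ r)))) ⟩
      suc (rank (y + m) s + rank (y + m) (shift m (q ++ r))) ≡⟨ cong suc (rank-++ (y + m) s _) ⟨
      suc (rank (y + m) X) ∎

  h-max : ∀ {a z b} → s ≡ a ++ z ∷ b → All (_< z) a → All (_< z) b → h (suc m̃) ≡ z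
  h-max {a} {z} {b} refl a<z b<z = trans (cong (h ∘ suc) (sym rk)) (h-low (∈-insert a))
    where
    rk : rank z (a ++ z ∷ b) ≡ m̃
    rk = begin
      rank z (a ++ z ∷ b) ≡⟨ rank-++ z a (z ∷ b) ⟩
      rank z a + rank z (z ∷ b) ≡⟨ cong₂ _+_ (rank-all a<z) (trans (rank-cons-≥ {z} {z} b ℕₚ.≤-refl) (rank-all b<z)) ⟩
      length a + length b ≡⟨ ℕₚ.suc-injective (trans (sym (ℕₚ.+-suc (length a) (length b))) (trans (sym (length-++ a)) ls)) ⟩
      m̃ ∎
      where open ≡-Reasoning

  h-shift : ∀ t → All (_∈ q ++ r) t → map h (shift m̃ t) ≡ shift m t
  h-shift t al = trans (sym (map-∘ t)) (map-cong-local (All.map h-high al))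

  //-relabel : ∀ σ → σ ↭ range1 (suc (m̃ + n)) → A // σ ≡ A ++ map h σ
  //-relabel σ q = cong (A ++_) (trans (cong (λ N → map (orderMap A σ N) σ) lengths) (orderMap-relabel σ (↭-trans q (↭-reflexive (cong range1 (sym length-X))))))
    where
    lengths : length A + length σ ≡ suc (m + n)
    lengths = begin
      length A + length σ ≡⟨ cong (length A +_) (trans (↭-length q) (trans (length-range1 _) (sym length-X))) ⟩
      length A + length X ≡⟨ length-++ A ⟨
      length (A ++ X) ≡⟨ trans (↭-length A++X) (length-range1 _) ⟩
      suc (m + n) ∎
      where open ≡-Reasoning

-- The mirror branch. Now `h` fixes the letters of the first word other than `m + 1`, and the shared
-- letter `m + 1` goes to the minimum of the shifted `q`.
module Right (m n k̃ : ℕ) (p s q r : Word) (pu : p ++ suc m ∷ s ↭ range1 (suc m)) (pv : q ++ 1 ∷ r ↭ range1 (suc n))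
  (lq : length q ≡ suc k̃) where

  B X : Word
  B = suc m ∷ shift m r
  X = (p ++ s) ++ shift m q

  B++X : B ++ X ↭ range1 (suc (m + n))
  B++X = begin
    B ++ (p ++ s) ++ shift m q ↭⟨ ++-comm B X ⟩
    ((p ++ s) ++ shift m q) ++ suc m ∷ shift m r ↭⟨ ↭-shift (suc m) X (shift m r) ⟩
    suc m ∷ ((p ++ s) ++ shift m q) ++ shift m r ≡⟨ cong (suc m ∷_) (trans (++-assoc (p ++ s) _ _) (cong ((p ++ s) ++_) (sym (map-++ (_+ m) q r)))) ⟩
    (suc m ∷ p ++ s) ++ shift m (q ++ r) ↭⟨ ++⁺ʳ (shift m (q ++ r)) (↭-shift (suc m) p s) ⟨
    (p ++ suc m ∷ s) ++ shift m (q ++ r) ↭⟨ merged-↭ m n _ q r pu pv ⟩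
    range1 (suc (m + n)) ∎
    where open PermutationReasoning

  open Relabel B X (suc (m + n)) B++X public

  p++s-range : All (InRange m) (p ++ s)
  p++s-range = remove-max-range m p s pu

  length-p++s : length (p ++ s) ≡ m
  length-p++s = trans (↭-length (remove-max m p s pu)) (length-range1 m)

  length-X : length X ≡ suc (m + k̃)
  length-X = begin
    length X ≡⟨ length-++ (p ++ s) ⟩
    length (p ++ s) + length (shift m q) ≡⟨ cong₂ _+_ length-p++s (trans (length-map (_+ m) q) lq) ⟩
    m + suc k̃ ≡⟨ ℕₚ.+-suc m k̃ ⟩
    suc (m + k̃) ∎
    where open ≡-Reasoning

  fl-q : fl q ↭ range1 (suc k̃)
  fl-q = ↭-trans (fl-↭ (compl-↭ (1 ∷ r) q (suc n) (↭-trans (↭-trans (++-comm (1 ∷ r) q) ↭-refl) pv)) (compl-increasing (1 ∷ r) (suc n))) (↭-reflexive (cong range1 lq))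

  h-low : ∀ {x} → x ∈ p ++ s → h x ≡ x
  h-low {x} x∈ = trans (cong h e) (relabel-rank (∈-++⁺ˡ x∈))
    where
    open ≡-Reasoning
    rx = All.lookup p++s-range x∈
    e : x ≡ suc (rank x X)
    e = begin
      x ≡⟨ ℕₚ.suc-pred x ⦃ >-nonZero (proj₁ rx) ⦄ ⟨
      suc (pred x) ≡⟨ cong suc (rank-range1 rx) ⟨
      suc (rank x (range1 m)) ≡⟨ cong suc (rank-↭ x (↭-sym (remove-max m p s pu))) ⟩
      suc (rank x (p ++ s)) ≡⟨ cong suc (ℕₚ.+-identityʳ _) ⟨
      suc (rank x (p ++ s) + 0) ≡⟨ cong (λ k → suc (rank x (p ++ s) + k)) (rank-none (Allₚ.map⁺ (All.universal (λ y → ℕₚ.≤-trans (proj₂ rx) (ℕₚ.m≤n+m m y)) q))) ⟨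
      suc (rank x (p ++ s) + rank x (shift m q)) ≡⟨ cong suc (rank-++ x (p ++ s) _) ⟨
      suc (rank x X) ∎

  h-high : ∀ {y} → y ∈ q → h (suc (rank y q) + m) ≡ y + m
  h-high {y} y∈ = trans (cong h e) (relabel-rank (∈-++⁺ʳ (p ++ s) (∈-map⁺ (_+ m) y∈)))
    where
    open ≡-Reasoning
    1≤y : 1 ≤ y
    1≤y = proj₁ (All.lookup (range1-InRange (suc n)) (∈-resp-↭ pv (∈-++⁺ˡ y∈)))
    e : suc (rank y q) + m ≡ suc (rank (y + m) X)
    e = begin
      suc (rank y q) + m ≡⟨ cong suc (ℕₚ.+-comm (rank y q) m) ⟩
      suc (m + rank y q) ≡⟨ cong suc (cong₂ _+_ (sym (trans (rank-all (All.map (λ (_ , l) → ℕₚ.≤-<-trans l (ℕₚ.m<n+m m 1≤y)) p++s-range)) length-p++s)) (sym (rank-shift m y q))) ⟩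
      suc (rank (y + m) (p ++ s) + rank (y + m) (shift m q)) ≡⟨ cong suc (rank-++ (y + m) (p ++ s) _) ⟨
      suc (rank (y + m) X) ∎

  h-fl : map h (shift m (fl q)) ≡ shift m q
  h-fl = trans (trans (cong (map h) (sym (map-∘ q))) (sym (map-∘ q))) (map-cong-local (All.tabulate h-high))

  h-min : ∀ {a z b} → q ≡ a ++ z ∷ b → All (z <_) a → All (z <_) b → h (suc m) ≡ z + m
  h-min {a} {z} {b} refl z<a z<b = trans (cong (λ k → h (suc k + m)) (sym rk)) (h-high (∈-insert a))
    where
    rk : rank z (a ++ z ∷ b) ≡ 0
    rk = rank-none (Allₚ.++⁺ (All.map ℕₚ.<⇒≤ z<a) (ℕₚ.≤-refl ∷ All.map ℕₚ.<⇒≤ z<b))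

  \\-relabel : ∀ σ → σ ↭ range1 (suc (m + k̃)) → σ \\ B ≡ map h σ ++ B
  \\-relabel σ q = cong (_++ B) (trans (cong (λ N → map (orderMap B σ N) σ) lengths) (orderMap-relabel σ (↭-trans q (↭-reflexive (cong range1 (sym length-X))))))
    where
    lengths : length σ + length B ≡ suc (m + n)
    lengths = begin
      length σ + length B ≡⟨ ℕₚ.+-comm (length σ) (length B) ⟩
      length B + length σ ≡⟨ cong (length B +_) (trans (↭-length q) (trans (length-range1 _) (sym length-X))) ⟩
      length B + length X ≡⟨ length-++ B ⟨
      length (B ++ X) ≡⟨ trans (↭-length B++X) (length-range1 _) ⟩
      suc (m + n) ∎
      where open ≡-Reasoning

<ᵇ-total : ∀ {a b} → a ≢ b → (a <ᵇ b) ≡ false → (b <ᵇ a) ≡ true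
<ᵇ-total a≢b e = <ᵇ-true (ℕₚ.≤∧≢⇒< (<ᵇ-false⁻ e) (a≢b ∘ sym))

maxima-blocks : ∀ m u → u ↭ range1 (suc m) →
  ∃₂ λ p U → u ≡ p ++ suc m ∷ flat U × All (Std._≺ suc m) p × Below Std._≺_ (suc m) U
maxima-blocks m u pu = Std.decompose (λ {a} {b} → <ᵇ-total {a} {b})
  (↭-trans pu (↭-trans (↭-reflexive (range1-∷ʳ m)) (++-comm (range1 m) (suc m ∷ []))))
  (increasing-unique (range1-increasing m)) (All.map (<ᵇ-true ∘ s≤s ∘ proj₂) (range1-InRange m))

shift-range1-∷ : ∀ m n → shift m (range1 (suc n)) ≡ suc m ∷ shift (suc m) (range1 n)
shift-range1-∷ m n = trans (cong (shift m) (range1-∷ n)) (cong (suc m ∷_) (shift-+ m 1 (range1 n)))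

minima-blocks : ∀ m n v → v ↭ range1 (suc n) →
  ∃₂ λ r V → shift m v ≡ reverse (r ++ suc m ∷ flat V) × All (Opp._≺ suc m) r × Below Opp._≺_ (suc m) V
minima-blocks m n v pv with Opp.decompose (λ {a} {b} a≢b e → <ᵇ-total {b} {a} (a≢b ∘ sym) e)
  (↭-trans (↭-reverse (shift m v)) (↭-trans (↭-map⁺ (_+ m) pv) (↭-reflexive (shift-range1-∷ m n))))
  (Uniqueₚ.map⁺ (λ {x} {y} → ℕₚ.+-cancelʳ-≡ (suc m) x y) (increasing-unique (range1-increasing n)))
  (Allₚ.map⁺ (All.map (λ (l , _) → <ᵇ-true (ℕₚ.+-monoˡ-≤ (suc m) l)) (range1-InRange n)))
... | r , V , e , r>c , bV = r , V , trans (sym (reverse-involutive (shift m v))) (cong reverse e) , r>c , bV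

mix-range1 : ∀ m n v p U r V → p ++ suc m ∷ flat U ↭ range1 (suc m) → v ↭ range1 (suc n) →
  shift m v ≡ reverse (r ++ suc m ∷ flat V) → All (_↭ range1 (suc (m + n))) (mix (suc m) p U r V)
mix-range1 m n v p U r V pu pv ev = All.map (λ q → ↭-trans q all) (mix-↭ (suc m) p U r V)
  where
  open PermutationReasoning
  all : (p ++ flat U) ++ suc m ∷ (r ++ flat V) ↭ range1 (suc (m + n))
  all = begin
    (p ++ flat U) ++ suc m ∷ (r ++ flat V) ↭⟨ ++⁺ (remove-max m p (flat U) pu) (↭-sym (↭-shift (suc m) r (flat V))) ⟩
    range1 m ++ r ++ suc m ∷ flat V ↭⟨ ++⁺ˡ (range1 m) (↭-reverse (r ++ suc m ∷ flat V)) ⟨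
    range1 m ++ reverse (r ++ suc m ∷ flat V) ≡⟨ cong (range1 m ++_) ev ⟨
    range1 m ++ shift m v ↭⟨ ++⁺ˡ (range1 m) (↭-map⁺ (_+ m) pv) ⟩
    range1 m ++ shift m (range1 (suc n)) ≡⟨ range1-+ m (suc n) ⟨
    range1 (m + suc n) ≡⟨ cong range1 (ℕₚ.+-suc m n) ⟩
    range1 (suc (m + n)) ∎

-- The renaming g absorbs the relabellings fl, // and \\ accumulated along the recursion of 𝓢′.
IsMix : ℕ → Set
IsMix f = ∀ g m n u v c p U r V → u ↭ range1 (suc m) → v ↭ range1 (suc n) → length u + length v ≤ f →
  Mono g (suc (m + n)) → g (suc m) ≡ c → map g u ≡ p ++ c ∷ flat U → map g (shift m v) ≡ reverse (r ++ c ∷ flat V) →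
  Below Std._≺_ c U → Below Opp._≺_ c V → map (map g) (𝓢′ f u v) ≡ mix c p U r V

IsMix-id : ∀ {f} → IsMix f → ∀ m n p U r V v → p ++ suc m ∷ flat U ↭ range1 (suc m) → v ↭ range1 (suc n) →
  length (p ++ suc m ∷ flat U) + length v ≤ f → shift m v ≡ reverse (r ++ suc m ∷ flat V) →
  Below Std._≺_ (suc m) U → Below Opp._≺_ (suc m) V → 𝓢′ f (p ++ suc m ∷ flat U) v ≡ mix (suc m) p U r V
IsMix-id im m n p U r V v pu pv l ev bU bV =
  trans (sym (trans (map-cong map-id _) (map-id _)))
    (im id m n _ v (suc m) p U r V pu pv l (λ _ x<y _ → x<y) refl (map-id _) (trans (map-id _) ev) bU bV)

-- The mix keeps all letters, so `IsMix` itself shows that members are permutations; the relabelling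
-- lemmas for the two branches need this of the recursive results.
𝓢-range1 : ∀ {f} → IsMix f → ∀ m n u v → u ↭ range1 (suc m) → v ↭ range1 (suc n) → length u + length v ≤ f →
  All (_↭ range1 (suc (m + n))) (𝓢′ f u v)
𝓢-range1 im m n u v pu pv l with maxima-blocks m u pu | minima-blocks m n v pv
... | p , U , refl , _ , bU | r , V , ev , _ , bV =
  subst (All (_↭ range1 (suc (m + n)))) (sym (IsMix-id im m n p U r V v pu pv l ev bU bV)) (mix-range1 m n v p U r V pu pv ev)

reverse-mid : ∀ (r : Word) c F → reverse (r ++ c ∷ F) ≡ reverse F ++ c ∷ reverse r
reverse-mid r c F = begin
  reverse (r ++ c ∷ F) ≡⟨ reverse-++ r (c ∷ F) ⟩
  reverse (c ∷ F) ++ reverse r ≡⟨ cong (_++ reverse r) (unfold-reverse c F) ⟩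
  (reverse F ++ c ∷ []) ++ reverse r ≡⟨ ++-assoc (reverse F) (c ∷ []) (reverse r) ⟩
  reverse F ++ c ∷ reverse r ∎
  where open ≡-Reasoning

shift-split : ∀ m q r → shift m (q ++ 1 ∷ r) ≡ shift m q ++ suc m ∷ shift m r
shift-split m q r = map-++ (_+ m) q (1 ∷ r)

All-map⁻ : ∀ (g : ℕ → ℕ) {P : ℕ → Set} s {t} → map g s ≡ t → All P t → All (P ∘ g) s
All-map⁻ g s refl al = Allₚ.map⁻ al

-- Both words are split at the shared letter, which is `m + 1` in the first and 1 in the unshifted
-- second word.
module Cases (g : ℕ → ℕ) (m n : ℕ) (p₀ s₀ q₀ r₀ : Word) (c : ℕ) (p : Word) (U : Blocks) (r : Word) (V : Blocks)
  (pu : p₀ ++ suc m ∷ s₀ ↭ range1 (suc m)) (pv : q₀ ++ 1 ∷ r₀ ↭ range1 (suc n))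
  (gc : g (suc m) ≡ c)
  (gp : map g p₀ ≡ p) (gs : map g s₀ ≡ flat U) (gq : map g (shift m q₀) ≡ reverse (flat V)) (gr : map g (shift m r₀) ≡ reverse r) where

  u v : Word
  u = p₀ ++ suc m ∷ s₀
  v = q₀ ++ 1 ∷ r₀

  gu : map g u ≡ p ++ c ∷ flat U
  gu = trans (map-++ g p₀ _) (cong₂ _++_ gp (cong₂ _∷_ gc gs))

  gv : map g (shift m v) ≡ reverse (r ++ c ∷ flat V)
  gv = begin
    map g (shift m v) ≡⟨ cong (map g) (shift-split m q₀ r₀) ⟩
    map g (shift m q₀ ++ suc m ∷ shift m r₀) ≡⟨ map-++ g (shift m q₀) _ ⟩
    map g (shift m q₀) ++ g (suc m) ∷ map g (shift m r₀) ≡⟨ cong₂ _++_ gq (cong₂ _∷_ gc gr) ⟩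
    reverse (flat V) ++ c ∷ reverse r ≡⟨ reverse-mid r c (flat V) ⟨
    reverse (r ++ c ∷ flat V) ∎
    where open ≡-Reasoning

  length-u : length u ≡ suc m
  length-u = trans (↭-length pu) (length-range1 (suc m))

  removed-range : All (InRange m) (p₀ ++ s₀)
  removed-range = remove-max-range m p₀ s₀ pu

  m+1∉p₀ : suc m ∉ p₀
  m+1∉p₀ q = ℕₚ.1+n≰n (proj₂ (All.lookup removed-range (∈-++⁺ˡ q)))

  m+1∉s₀ : suc m ∉ s₀
  m+1∉s₀ q = ℕₚ.1+n≰n (proj₂ (All.lookup removed-range (∈-++⁺ʳ p₀ q)))

  1∉q₀ : 1 ∉ q₀
  1∉q₀ q = ℕₚ.<-irrefl refl (All.lookup (remove-min-range n q₀ r₀ pv) (∈-++⁺ˡ q))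

  u-range : ∀ {x} → x ∈ p₀ ++ s₀ → InRange (suc (m + n)) x
  u-range x∈ with All.lookup removed-range x∈
  ... | 1≤x , x≤m = 1≤x , ℕₚ.≤-trans x≤m (ℕₚ.≤-trans (ℕₚ.m≤m+n m n) (ℕₚ.n≤1+n _))

  v-range : ∀ {x} → x ∈ q₀ → InRange (suc (m + n)) (x + m)
  v-range {x} x∈ with All.lookup (range1-InRange (suc n)) (∈-resp-↭ pv (∈-++⁺ˡ x∈))
  ... | 1≤x , x≤n = ℕₚ.≤-trans 1≤x (ℕₚ.m≤m+n x m) , ℕₚ.≤-trans (ℕₚ.+-monoˡ-≤ m x≤n) (ℕₚ.≤-reflexive (cong suc (ℕₚ.+-comm n m)))
[]≢++∷ : ∀ (p : Word) {c s} → [] ≢ p ++ c ∷ s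
[]≢++∷ [] ()
[]≢++∷ (_ ∷ _) ()

suffix-shorter : ∀ (p : Word) c s → length s < length (p ++ c ∷ s)
suffix-shorter p c s = ℕₚ.≤-trans (s≤s (length-++-≤ʳ s {p})) (ℕₚ.≤-reflexive (sym (length-++-sucʳ p c s)))

prefix-shorter : ∀ (p : Word) c s → length p < length (p ++ c ∷ s)
prefix-shorter p c s = ℕₚ.≤-trans (s≤s (length-++-≤ˡ p)) (ℕₚ.≤-reflexive (sym (length-++-sucʳ p c s)))

-- Emptiness of `s₀` and `q₀` decides the case of the recursion, and `gs` and `gq` force `U` and `V`
-- to agree with it; the first four clauses are the mismatches.
𝓢-mix : ∀ f → IsMix f → ∀ g m n p₀ s₀ q₀ r₀ c p U r V →
  p₀ ++ suc m ∷ s₀ ↭ range1 (suc m) → q₀ ++ 1 ∷ r₀ ↭ range1 (suc n) →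
  length (p₀ ++ suc m ∷ s₀) + length (q₀ ++ 1 ∷ r₀) ≤ suc f →
  Mono g (suc (m + n)) → g (suc m) ≡ c →
  map g p₀ ≡ p → map g s₀ ≡ flat U → map g (shift m q₀) ≡ reverse (flat V) → map g (shift m r₀) ≡ reverse r →
  Below Std._≺_ c U → Below Opp._≺_ c V →
  map (map g) (𝓢′ (suc f) (p₀ ++ suc m ∷ s₀) (q₀ ++ 1 ∷ r₀)) ≡ mix c p U r V
𝓢-mix f im g m n p₀ [] q₀ r₀ c p ((M , p′) ∷ U) r V pu pv fuel mono gc gp gs gq gr bU bV = contradiction gs ([]≢++∷ p′)
𝓢-mix f im g m n p₀ (y ∷ s) q₀ r₀ c p [] r V pu pv fuel mono gc gp () gq gr bU bV
𝓢-mix f im g m n p₀ s₀ [] r₀ c p U r ((k , r′) ∷ V) pu pv fuel mono gc gp gs gq gr bU bV =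
  contradiction (trans gq (reverse-mid r′ k (flat V))) ([]≢++∷ (reverse (flat V)))
𝓢-mix f im g m n p₀ s₀ (x ∷ q) r₀ c p U r [] pu pv fuel mono gc gp gs () gr bU bV
𝓢-mix f im g m n p₀ [] q₀ r₀ c p [] r V pu pv fuel mono gc gp gs gq gr bU bV = begin
  map (map g) (𝓢′ (suc f) (p₀ ++ suc m ∷ []) v) ≡⟨ cong (map (map g)) (trans (𝓢-unfold f m u v length-u) (𝓢-last f m p₀ v lp)) ⟩
  map g (p₀ ++ shift m v) ∷ [] ≡⟨ cong (_∷ []) (trans (map-++ g p₀ _) (cong₂ _++_ gp gv)) ⟩
  (p ++ reverse (r ++ c ∷ flat V)) ∷ [] ∎
  where
  open ≡-Reasoning
  open Cases g m n p₀ [] q₀ r₀ c p [] r V pu pv gc gp gs gq gr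
  lp : length p₀ ≡ m
  lp = ℕₚ.suc-injective (trans (sym (trans (length-++-sucʳ p₀ (suc m) []) (cong (suc ∘ length) (++-identityʳ p₀)))) length-u)
𝓢-mix f im g m n p₀ (y ∷ s) [] r₀ c p U@(_ ∷ _) r [] pu pv fuel mono gc gp gs gq gr bU bV = begin
  map (map g) (𝓢′ (suc f) u (1 ∷ r₀)) ≡⟨ cong (map (map g)) (trans (𝓢-unfold f m u v length-u) (𝓢-head f m p₀ y s r₀ m+1∉s₀)) ⟩
  map g (u ++ shift m r₀) ∷ [] ≡⟨ cong (_∷ []) (trans (map-++ g u _) (cong₂ _++_ gu gr)) ⟩
  ((p ++ c ∷ flat U) ++ reverse r) ∷ [] ∎
  where
  open ≡-Reasoning
  open Cases g m n p₀ (y ∷ s) [] r₀ c p U r [] pu pv gc gp gs gq gr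
𝓢-mix f im g m n p₀ s₀@(y ∷ s) q₀@(x ∷ q) r₀ c p U@((M , p′) ∷ U′) r V@((k , r′) ∷ V′) pu pv fuel mono gc gp gs gq gr
  bU@(cons M≺c p′≺M bU′) bV@(cons c≺k k≺r′ bV′) = begin
  map (map g) (𝓢′ (suc f) u v) ≡⟨ cong (map (map g)) (trans (𝓢-unfold f m u v length-u) (𝓢-rec f m p₀ y s x q r₀ m+1∉p₀ m+1∉s₀ 1∉q₀)) ⟩
  map (map g) (map (L.A //_) Sₗ ++ map (_\\ R.B) Sᵣ) ≡⟨ map-++ (map g) (map (L.A //_) Sₗ) _ ⟩
  map (map g) (map (L.A //_) Sₗ) ++ map (map g) (map (_\\ R.B) Sᵣ) ≡⟨ cong₂ _++_ left right ⟩
  mix c p U r V ∎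
  where
  open ≡-Reasoning
  open Cases g m n p₀ s₀ q₀ r₀ c p U r V pu pv gc gp gs gq gr
  m̃ = length s
  k̃ = length q
  module L = Left m n m̃ p₀ s₀ q₀ r₀ pu pv refl
  module R = Right m n k̃ p₀ s₀ q₀ r₀ pu pv refl
  Sₗ = 𝓢′ f (fl s₀) v
  Sᵣ = 𝓢′ f u (fl q₀)

  fuelₗ : length (fl s₀) + length v ≤ f
  fuelₗ = ℕₚ.≤-pred (ℕₚ.≤-trans (ℕₚ.+-monoˡ-< (length v) (subst (_< length u) (sym (length-map _ s₀)) (suffix-shorter p₀ (suc m) s₀))) fuel)

  fuelᵣ : length u + length (fl q₀) ≤ f
  fuelᵣ = ℕₚ.≤-pred (ℕₚ.≤-trans (ℕₚ.+-monoʳ-< (length u) (subst (_< length v) (sym (length-map _ q₀)) (prefix-shorter q₀ 1 r₀))) fuel)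

  -- `M` is the largest letter of `map g s₀` and `g` reflects the order, so its preimage `z` is the
  -- maximum of `s₀`, where `h` sends the new shared letter.
  new-max : g (L.h (suc m̃)) ≡ M
  new-max with map-split g s₀ {p′} gs
  ... | a , z , b , e , ga , gz , gb = trans (cong g (L.h-max e (smaller a (λ i → subst (_ ∈_) (sym e) (∈-++⁺ˡ i)) ga p′≺M)
      (smaller b (λ i → subst (_ ∈_) (sym e) (∈-++⁺ʳ a (there i))) gb (Below-flat (λ {i} {j} {l} → <ᵇ-trans i j l) bU′)))) gz
    where
    smaller : ∀ t {w} → (∀ {i} → i ∈ t → i ∈ s₀) → map g t ≡ w → All (Std._≺ M) w → All (_< z) t
    smaller t sub gt w≺M = All.tabulate (λ {i} i∈ → Mono-reflects mono (u-range (∈-++⁺ʳ p₀ (sub i∈)))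
      (u-range (∈-++⁺ʳ p₀ (subst (z ∈_) (sym e) (∈-insert a))))
      (subst (g i <_) (sym gz) (<ᵇ-true⁻ (All.lookup (All-map⁻ g t gt w≺M) i∈))))

  new-min : g (R.h (suc m)) ≡ k
  new-min with map-split (g ∘ (_+ m)) q₀ {reverse (flat V′)} (trans (map-∘ q₀) (trans gq (reverse-mid r′ k (flat V′))))
  ... | a , z , b , e , ga , gz , gb = trans (cong g (R.h-min e (larger a (λ i → subst (_ ∈_) (sym e) (∈-++⁺ˡ i)) ga
        (All-resp-↭ (↭-sym (↭-reverse (flat V′))) (Below-flat {R = Opp._≺_} (λ {i} {j} {l} u v → <ᵇ-trans l j i v u) bV′)))
      (larger b (λ i → subst (_ ∈_) (sym e) (∈-++⁺ʳ a (there i))) gb (All-resp-↭ (↭-sym (↭-reverse r′)) k≺r′)))) gz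
    where
    larger : ∀ t {w} → (∀ {i} → i ∈ t → i ∈ q₀) → map (g ∘ (_+ m)) t ≡ w → All (Opp._≺ k) w → All (z <_) t
    larger t sub gt k≺w = All.tabulate (λ {i} i∈ → ℕₚ.+-cancelʳ-< m z i (Mono-reflects mono (v-range (subst (z ∈_) (sym e) (∈-insert a))) (v-range (sub i∈))
      (subst (_< g (i + m)) (sym gz) (<ᵇ-true⁻ (All.lookup (All-map⁻ (g ∘ (_+ m)) t gt k≺w) i∈)))))

  gvₗ : map (g ∘ L.h) (shift m̃ v) ≡ reverse (r ++ M ∷ flat V)
  gvₗ = begin
    map (g ∘ L.h) (shift m̃ v) ≡⟨ cong (map (g ∘ L.h)) (shift-split m̃ q₀ r₀) ⟩
    map (g ∘ L.h) (shift m̃ q₀ ++ suc m̃ ∷ shift m̃ r₀) ≡⟨ map-++ (g ∘ L.h) (shift m̃ q₀) _ ⟩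
    map (g ∘ L.h) (shift m̃ q₀) ++ g (L.h (suc m̃)) ∷ map (g ∘ L.h) (shift m̃ r₀)
      ≡⟨ cong₂ _++_ (trans (map-∘ (shift m̃ q₀)) (trans (cong (map g) (L.h-shift q₀ (All.tabulate (λ {i} i∈ → ∈-++⁺ˡ i∈)))) gq))
          (cong₂ _∷_ new-max (trans (map-∘ (shift m̃ r₀)) (trans (cong (map g) (L.h-shift r₀ (All.tabulate (∈-++⁺ʳ q₀)))) gr))) ⟩
    reverse (flat V) ++ M ∷ reverse r ≡⟨ reverse-mid r M (flat V) ⟨
    reverse (r ++ M ∷ flat V) ∎

  guᵣ : map (g ∘ R.h) u ≡ p ++ k ∷ flat U
  guᵣ = begin
    map (g ∘ R.h) u ≡⟨ map-++ (g ∘ R.h) p₀ _ ⟩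
    map (g ∘ R.h) p₀ ++ g (R.h (suc m)) ∷ map (g ∘ R.h) s₀
      ≡⟨ cong₂ _++_ (trans (fixed p₀ ∈-++⁺ˡ) gp) (cong₂ _∷_ new-min (trans (fixed s₀ (∈-++⁺ʳ p₀)) gs)) ⟩
    p ++ k ∷ flat U ∎
    where
    fixed : ∀ t → (∀ {i} → i ∈ t → i ∈ p₀ ++ s₀) → map (g ∘ R.h) t ≡ map g t
    fixed t sub = map-cong-local (All.tabulate (λ i∈ → cong g (R.h-low (sub i∈))))

  monoₗ : Mono (g ∘ L.h) (suc (m̃ + n))
  monoₗ {x} {y} 1≤x x<y y≤ = L.mono-relabel {g} mono {x} {y} 1≤x x<y (subst (y ≤_) (sym L.length-X) y≤)

  monoᵣ : Mono (g ∘ R.h) (suc (m + k̃))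
  monoᵣ {x} {y} 1≤x x<y y≤ = R.mono-relabel {g} mono {x} {y} 1≤x x<y (subst (y ≤_) (sym R.length-X) y≤)

  -- `M` may replace `c` below the minima in `V` because `M < c < k`.
  mixₗ : map (map (g ∘ L.h)) Sₗ ≡ mix M p′ U′ r V
  mixₗ = im (g ∘ L.h) m̃ n (fl s₀) v M p′ U′ r V L.fl-s pv fuelₗ (λ {x} {y} → monoₗ {x} {y}) new-max
    (trans (map-∘ (fl s₀)) (trans (cong (map g) L.h-fl) gs)) gvₗ bU′ (cons (<ᵇ-trans M c k M≺c c≺k) k≺r′ bV′)

  mixᵣ : map (map (g ∘ R.h)) Sᵣ ≡ mix k p U r′ V′
  mixᵣ = im (g ∘ R.h) m k̃ u (fl q₀) k p U r′ V′ pu R.fl-q fuelᵣ (λ {x} {y} → monoᵣ {x} {y}) new-min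
    guᵣ (trans (map-∘ (shift m (fl q₀))) (trans (cong (map g) R.h-fl) gq)) (cons (<ᵇ-trans M c k M≺c c≺k) p′≺M bU′) bV′

  left : map (map g) (map (L.A //_) Sₗ) ≡ map ((p ++ c ∷ []) ++_) (mix M p′ U′ r V)
  left = begin
    map (map g) (map (L.A //_) Sₗ) ≡⟨ map-∘ Sₗ ⟨
    map (λ σ → map g (L.A // σ)) Sₗ ≡⟨ map-cong-local (All.map (λ {σ} q → entry σ q) (𝓢-range1 im m̃ n (fl s₀) v L.fl-s pv fuelₗ)) ⟩
    map (λ σ → (p ++ c ∷ []) ++ map (g ∘ L.h) σ) Sₗ ≡⟨ map-∘ Sₗ ⟩
    map ((p ++ c ∷ []) ++_) (map (map (g ∘ L.h)) Sₗ) ≡⟨ cong (map ((p ++ c ∷ []) ++_)) mixₗ ⟩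
    map ((p ++ c ∷ []) ++_) (mix M p′ U′ r V) ∎
    where
    entry : ∀ σ → σ ↭ range1 (suc (m̃ + n)) → map g (L.A // σ) ≡ (p ++ c ∷ []) ++ map (g ∘ L.h) σ
    entry σ q = trans (cong (map g) (L.//-relabel σ q)) (trans (map-++ g L.A _)
      (cong₂ _++_ (trans (map-++ g p₀ _) (cong₂ (λ a b → a ++ b ∷ []) gp gc)) (sym (map-∘ σ))))

  right : map (map g) (map (_\\ R.B) Sᵣ) ≡ map (_++ reverse (r ++ c ∷ [])) (mix k p U r′ V′)
  right = begin
    map (map g) (map (_\\ R.B) Sᵣ) ≡⟨ map-∘ Sᵣ ⟨
    map (λ σ → map g (σ \\ R.B)) Sᵣ ≡⟨ map-cong-local (All.map (λ {σ} q → entry σ q) (𝓢-range1 im m k̃ u (fl q₀) pu R.fl-q fuelᵣ)) ⟩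
    map (λ σ → map (g ∘ R.h) σ ++ reverse (r ++ c ∷ [])) Sᵣ ≡⟨ map-∘ Sᵣ ⟩
    map (_++ reverse (r ++ c ∷ [])) (map (map (g ∘ R.h)) Sᵣ) ≡⟨ cong (map (_++ reverse (r ++ c ∷ []))) mixᵣ ⟩
    map (_++ reverse (r ++ c ∷ [])) (mix k p U r′ V′) ∎
    where
    entry : ∀ σ → σ ↭ range1 (suc (m + k̃)) → map g (σ \\ R.B) ≡ map (g ∘ R.h) σ ++ reverse (r ++ c ∷ [])
    entry σ q = trans (cong (map g) (R.\\-relabel σ q)) (trans (map-++ g (map R.h σ) _)
      (cong₂ _++_ (sym (map-∘ σ)) (trans (cong₂ _∷_ gc gr) (sym (reverse-++ r (c ∷ []))))))

-- Injectivity of `g` identifies the letters sent to `c` as `m + 1` and the unshifted 1. Without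
-- fuel `u` would be empty, which a permutation of `m + 1` letters is not.
isMix : ∀ f → IsMix f
isMix zero g m n [] v c p U r V pu pv fuel = contradiction (trans (↭-length pu) (length-range1 (suc m))) λ ()
isMix (suc f) g m n u v c p U r V pu pv fuel mono gc gu gv bU bV
  with map-split g u {p} gu | map-split (g ∘ (_+ m)) v {reverse (flat V)} (trans (map-∘ v) (trans gv (reverse-mid r c (flat V))))
... | p₀ , z , s₀ , refl , gp , gz , gs | q₀ , y , r₀ , refl , gq , gy , gr
  with All.lookup (range1-InRange (suc m)) (∈-resp-↭ pu (∈-insert p₀)) | All.lookup (range1-InRange (suc n)) (∈-resp-↭ pv (∈-insert q₀))
... | 1≤z , z≤ | 1≤y , y≤
  with Mono-injective mono (1≤z , ℕₚ.≤-trans z≤ (s≤s (ℕₚ.m≤m+n m n))) (s≤s z≤n , s≤s (ℕₚ.m≤m+n m n)) (trans gz (sym gc))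
     | ℕₚ.+-cancelʳ-≡ m y 1 (Mono-injective mono (ℕₚ.≤-trans 1≤y (ℕₚ.m≤m+n y m) , ℕₚ.≤-trans (ℕₚ.+-monoˡ-≤ m y≤) (ℕₚ.≤-reflexive (cong suc (ℕₚ.+-comm n m)))) (s≤s z≤n , s≤s (ℕₚ.m≤m+n m n)) (trans gy (sym gc)))
... | refl | refl = 𝓢-mix f (isMix f) g m n p₀ s₀ q₀ r₀ c p U r V pu pv fuel mono gc gp gs
  (trans (sym (map-∘ q₀)) gq) (trans (sym (map-∘ r₀)) gr) bU bV

theorem4p6 : ∀ {c ℓ} (K : Field c ℓ) (m n : ℕ) (u v : Word)
    → u ↭ range1 (suc m) → v ↭ range1 (suc n)
    → _≈W_ K (∇sh (bracket m u) (bracket n v)) (concatMap (bracket (m + n)) (𝓢 u v))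
theorem4p6 K m n u v pu pv b with maxima-blocks m u pu | minima-blocks m n v pv
-- The counts agree in ℕ, so their images in the field do; the fuel chosen in `𝓢` meets the bound
-- with equality.
... | p , U , refl , p<c , bU | r , V , ev , r>c , bV = Field.reflexive K (cong (ιℕ K)
  (trans (count-mix m n p U r V v p<c bU r>c bV pu pv ev (mix-range1 m n v p U r V pu pv ev) b)
    (cong (λ S → count b (concatMap (bracket (m + n)) S))
      (sym (IsMix-id (isMix _) m n p U r V v pu pv ℕₚ.≤-refl ev bU bV)))))
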